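{- There is an absolute constant $c>0$ such that for every prime $p$ and every positive integer $\lambda\le 0.9\sqrt{p}$, the set $A=\{1,2,\dots,\lambda\}\subseteq\mathbb{F}_p^*$ satisfies $$\nu(A)\ge c\,\frac{p}{\lambda\log p}.$$
   Context: $\mathbb{F}_p^*$ is the multiplicative group of the field $\mathbb{F}_p$, whose elements are identified with integers in the usual way. For $A\subseteq\mathbb{F}_p^*$, a set $B\subseteq\mathbb{F}_p^*$ is an $A$-packing set if $|AB|=|A||B|$, where $AB=\{ab:a\in A,b\in B\}$; $\nu(A)$ is the maximal size of an $A$-packing set. $\log$ denotes the natural logarithm. -}

module Defs where

open import Data.Nat using (ℕ; suc; _*_; _≤_; _<_; _≟_; NonZero)
open import Data.Nat.DivMod using (_%_)
open import Data.List using (List; map; upTo; length; deduplicate; cartesianProductWith)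
open import Data.List.Relation.Unary.All using (All)
open import Data.List.Relation.Unary.Unique.Propositional using (Unique)
open import Data.Product using (_×_)
open import Relation.Binary.PropositionalEquality using (_≡_)

-- A finite subset of F_p^* is represented by a duplicate-free list of
-- integers in the range 1 .. p-1 (the usual identification).
IsSubsetFpStar : ℕ → List ℕ → Set
IsSubsetFpStar p B = Unique B × All (λ b → 1 ≤ b × b < p) B

productSet : (p : ℕ) → .{{_ : NonZero p}} → List ℕ → List ℕ → List ℕ
productSet p A B = deduplicate _≟_ (cartesianProductWith (λ a b → (a * b) % p) A B)

IsPackingSet : (p : ℕ) → .{{_ : NonZero p}} → List ℕ → List ℕ → Set
IsPackingSet p A B = IsSubsetFpStar p B × (length (productSet p A B) ≡ length A * length B)

interval : ℕ → List ℕ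
interval l = map suc (upTo l)

{-# OPTIONS --safe #-}

-- Put N = ⌊(p − 1)/λ⌋. For distinct primes q, q′ in (λ, N] and a, a′ ≤ λ the products a q and a′ q′ are smaller
-- than p and different, so these primes form a packing set. The hypothesis says λ ≤ 0.81 (N + 1), and 1/0.81 exceeds
-- Chebyshev's ratio 6/5; hence Chebyshev's integers (30n)! n! / ((15n)! (10n)! (6n)!) show that (λ, N] contains at
-- least a constant times N / log N primes. With θ(x) the logarithm of the product of the primes up to x and
-- C = 2¹⁴ 3⁹ 5⁵, the integer is Cⁿ up to a factor n, is at most exp θ(30n) up to the primes below √(30n), and is
-- at least exp (θ(30n) − θ(5n)). If N is bounded, {1} is large enough.

module Submission where

open import Defs
open import Data.Empty using (⊥-elim)
open import Data.List using (List; []; _∷_; _++_; cartesianProductWith; deduplicate; length; map)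
open import Data.List.Membership.Propositional using (_∈_)
open import Data.List.Membership.Propositional.Properties using (∈-cartesianProductWith⁻; ∈-map⁻; ∈-upTo⁻)
open import Data.List.Properties using (filter-all; length-++; length-map; map-++)
open import Data.List.Relation.Binary.Permutation.Propositional.Properties using () renaming (map⁺ to ↭-map⁺)
open import Data.List.Relation.Binary.Pointwise using (Pointwise; []; _∷_; decidable)
open import Data.List.Relation.Unary.All as All using (All; []; _∷_)
open import Data.List.Relation.Unary.All.Properties using () renaming (map⁺ to All-map⁺)
open import Data.List.Relation.Unary.AllPairs using ([]; _∷_)
open import Data.List.Relation.Unary.Any using (here; there)
open import Data.List.Relation.Unary.Unique.Propositional using (Unique)
open import Data.List.Relation.Unary.Unique.Propositional.Properties using (upTo⁺) renaming (map⁺ to Unique-map⁺; ++⁺ to Unique-++⁺)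
open import Data.Nat
open import Data.Nat.DivMod
open import Data.Nat.Divisibility
open import Data.Nat.Induction using (<-rec)
open import Data.Nat.ListAction using (product)
open import Data.Nat.ListAction.Properties using (product-++; product-↭)
open import Data.Nat.Logarithm using (⌊log₂_⌋; ⌊log₂⌋-mono-≤; ⌊log₂[2^n]⌋≡n)
open import Data.Nat.Primality
open import Data.Nat.Primality.Factorisation using (PrimeFactorisation; factorise)
open import Data.Nat.Properties
open import Data.Nat.Tactic.RingSolver using (solve-∀)
open import Data.List.Sort.InsertionSort ≤-decTotalOrder using (sort)
open import Data.List.Sort.InsertionSort.Properties ≤-decTotalOrder using (sort-↭)
open import Data.Product using (_×_; _,_; proj₁; proj₂; ∃-syntax)
open import Data.Sum using (inj₁; inj₂)
open import Function using (_∘_)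
open import Relation.Binary.PropositionalEquality
open import Relation.Nullary using (¬_; Dec; yes; no; contradiction)
open import Relation.Nullary.Decidable using (_×-dec_; ¬?; from-yes; toWitness)

-- Central binomial coefficients bound θ from both sides only up to a ratio 2, too coarse for an
-- interval as short as (0.81 N, N]; this forces Chebyshev's integers. The bound for θ is proved
-- with 121/100, which lies strictly between 6/5 and 1/0.81; the room left is 1 - 0.81 · 1.21 =
-- 0.0199. Real logarithms are avoided: θ becomes `primorial`, inequalities between logarithms
-- become inequalities between powers of `C`, and hundredth powers clear the denominator of 121/100.
-- Since the upper and the lower bound share the base `C`, nothing about its size is used except
-- `4380≤C`.

∑ ∏ : (ℕ → ℕ) → ℕ → ℕ
∑ f zero    = 0
∑ f (suc n) = ∑ f n + f (suc n)
∏ f zero    = 1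
∏ f (suc n) = ∏ f n * f (suc n)

∑-cong : ∀ {f g} → (∀ i → f i ≡ g i) → ∀ n → ∑ f n ≡ ∑ g n
∑-cong e zero    = refl
∑-cong e (suc n) = cong₂ _+_ (∑-cong e n) (e (suc n))

∑-+ : ∀ f g n → ∑ (λ i → f i + g i) n ≡ ∑ f n + ∑ g n
∑-+ f g zero    = refl
∑-+ f g (suc n) rewrite ∑-+ f g n = interchange (∑ f n) (∑ g n) (f (suc n)) (g (suc n))
  where
  interchange : ∀ a b c d → a + b + (c + d) ≡ a + c + (b + d)
  interchange = solve-∀

∑-head : ∀ f n → ∑ f (suc n) ≡ f 1 + ∑ (f ∘ suc) n
∑-head f zero    = sym (+-identityʳ (f 1))
∑-head f (suc n) = trans (cong (_+ f (2 + n)) (∑-head f n)) (+-assoc (f 1) _ _)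

∏-mono : ∀ {f g} n → (∀ i → 1 ≤ i → i ≤ n → f i ≤ g i) → ∏ f n ≤ ∏ g n
∏-mono zero    h = ≤-refl
∏-mono (suc n) h = *-mono-≤ (∏-mono n (λ i a b → h i a (m≤n⇒m≤1+n b))) (h (suc n) (s≤s z≤n) ≤-refl)

∏-cong : ∀ {f g} n → (∀ i → 1 ≤ i → i ≤ n → f i ≡ g i) → ∏ f n ≡ ∏ g n
∏-cong zero    h = refl
∏-cong (suc n) h = cong₂ _*_ (∏-cong n (λ i a b → h i a (m≤n⇒m≤1+n b))) (h (suc n) (s≤s z≤n) ≤-refl)

∏-* : ∀ f g n → ∏ (λ i → f i * g i) n ≡ ∏ f n * ∏ g n
∏-* f g zero    = refl
∏-* f g (suc n) rewrite ∏-* f g n = interchange (∏ f n) (∏ g n) (f (suc n)) (g (suc n))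
  where
  interchange : ∀ a b c d → a * b * (c * d) ≡ a * c * (b * d)
  interchange = solve-∀

∏-1 : ∀ n → ∏ (λ _ → 1) n ≡ 1
∏-1 zero    = refl
∏-1 (suc n) = trans (*-identityʳ _) (∏-1 n)

∏-extend : ∀ f m k → (∀ i → m < i → f i ≡ 1) → ∏ f (m + k) ≡ ∏ f m
∏-extend f m zero    h = cong (∏ f) (+-identityʳ m)
∏-extend f m (suc k) h rewrite +-suc m k =
  trans (cong (∏ f (m + k) *_) (h (suc (m + k)) (s≤s (m≤m+n m k))))
        (trans (*-identityʳ _) (∏-extend f m k h))

⟦_⟧ : ∀ {a} {P : Set a} → Dec P → ℕ
⟦ yes _ ⟧ = 1
⟦ no  _ ⟧ = 0

⟦⟧-yes : ∀ {a} {P : Set a} (d : Dec P) → P → ⟦ d ⟧ ≡ 1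
⟦⟧-yes (yes _) _ = refl
⟦⟧-yes (no ¬p) p = contradiction p ¬p

⟦⟧-no : ∀ {a} {P : Set a} (d : Dec P) → ¬ P → ⟦ d ⟧ ≡ 0
⟦⟧-no (yes p) ¬p = contradiction p ¬p
⟦⟧-no (no _)  _  = refl

⟦⟧-⇔ : ∀ {a b} {P : Set a} {Q : Set b} (d : Dec P) (e : Dec Q) → (P → Q) → (Q → P) → ⟦ d ⟧ ≡ ⟦ e ⟧
⟦⟧-⇔ (yes p) e f g = sym (⟦⟧-yes e (f p))
⟦⟧-⇔ (no ¬p) e f g = sym (⟦⟧-no e (¬p ∘ g))

-- Integers as products of prime powers

primePower : ℕ → ℕ → ℕ
primePower q a with prime? q
... | yes _ = q ^ a
... | no  _ = 1

primePower-cong : ∀ q {a b} → (Prime q → a ≡ b) → primePower q a ≡ primePower q b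
primePower-cong q h with prime? q
... | yes pq = cong (q ^_) (h pq)
... | no  _  = refl

primePower-mono : ∀ q {a b} → (Prime q → a ≤ b) → primePower q a ≤ primePower q b
primePower-mono q h with prime? q
... | yes pq = ^-monoʳ-≤ q {{prime⇒nonZero pq}} (h pq)
... | no  _  = ≤-refl

primePower-+ : ∀ q a b → primePower q (a + b) ≡ primePower q a * primePower q b
primePower-+ q a b with prime? q
... | yes _ = ^-distribˡ-+-* q a b
... | no  _ = refl

primePower-zero : ∀ q → primePower q 0 ≡ 1
primePower-zero q with prime? q
... | yes _ = refl
... | no  _ = refl

primePower>0 : ∀ q a → 1 ≤ primePower q a
primePower>0 q a with prime? q
... | yes pq = m^n>0 q {{prime⇒nonZero pq}} a
... | no  _  = ≤-refl

-- Encodes an integer by the exponents of its primes up to a common cutoff `N`. Factorials,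
-- primorials and Chebyshev's quotient can then be compared prime by prime, by adding exponents.
primePowers : ℕ → (ℕ → ℕ) → ℕ
primePowers N x = ∏ (λ q → primePower q (x q)) N

primePowers-cong : ∀ N {x y} → (∀ q → Prime q → x q ≡ y q) → primePowers N x ≡ primePowers N y
primePowers-cong N h = ∏-cong N (λ q _ _ → primePower-cong q (h q))

primePowers-+ : ∀ N x y → primePowers N (λ q → x q + y q) ≡ primePowers N x * primePowers N y
primePowers-+ N x y = trans (∏-cong N (λ q _ _ → primePower-+ q (x q) (y q))) (∏-* _ _ N)

primePowers-zero : ∀ N → primePowers N (λ _ → 0) ≡ 1
primePowers-zero N = trans (∏-cong N (λ q _ _ → primePower-zero q)) (∏-1 N)

primePowers>0 : ∀ N x → 1 ≤ primePowers N x
primePowers>0 N x = subst (_≤ primePowers N x) (∏-1 N) (∏-mono N (λ q _ _ → primePower>0 q (x q)))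

primePowers-single : ∀ N r → Prime r → r ≤ N → primePowers N (λ q → ⟦ q ≟ r ⟧) ≡ r
primePowers-single zero r pr r≤0 = ⊥-elim (¬prime[0] (subst Prime (n≤0⇒n≡0 r≤0) pr))
primePowers-single (suc N) r pr r≤N with suc N ≟ r
... | yes refl = trans (cong₂ _*_ (trans (∏-cong N below) (∏-1 N)) here′) (*-identityˡ _)
  where
  below : ∀ i → 1 ≤ i → i ≤ N → primePower i ⟦ i ≟ suc N ⟧ ≡ 1
  below i _ i≤N = trans (cong (primePower i) (⟦⟧-no (i ≟ suc N) (<⇒≢ (s≤s i≤N)))) (primePower-zero i)
  here′ : primePower (suc N) 1 ≡ suc N
  here′ with prime? (suc N)
  ... | yes _  = *-identityʳ _
  ... | no ¬pr = contradiction pr ¬pr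
... | no neq = trans (cong₂ _*_ (primePowers-single N r pr (≤-pred (≤∧≢⇒< r≤N (neq ∘ sym)))) (primePower-zero (suc N)))
                     (*-identityʳ r)

-- Legendre's formula

-- For a prime q this is the q-adic valuation once 1 ≤ m ≤ K, because q^k > k rules out every k ≥ m.
-- The form as a sum over k matches Legendre's sum term by term.
valuation : ℕ → ℕ → ℕ → ℕ
valuation K q m = ∑ (λ k → ⟦ q ^ k ∣? m ⟧) K

prime∣prime⇒≡ : ∀ {q r} → Prime q → Prime r → q ∣ r → q ≡ r
prime∣prime⇒≡ pq pr q∣r with prime⇒irreducible pr q∣r
... | inj₁ refl = ⊥-elim (¬prime[1] pq)
... | inj₂ eq   = eq

q^k∣rm⇒q^k∣m : ∀ {q r} → Prime q → Prime r → q ≢ r → ∀ k m → q ^ k ∣ r * m → q ^ k ∣ m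
q^k∣rm⇒q^k∣m pq pr q≢r zero m _ = 1∣ m
q^k∣rm⇒q^k∣m {q} {r} pq pr q≢r (suc k) m d with euclidsLemma r m pq (∣-trans (m∣m*n (q ^ k)) d)
... | inj₁ q∣r = contradiction (prime∣prime⇒≡ pq pr q∣r) q≢r
... | inj₂ (divides m′ refl) = subst (q ^ suc k ∣_) (*-comm q m′) (*-monoʳ-∣ q (q^k∣rm⇒q^k∣m pq pr q≢r k m′
        (*-cancelˡ-∣ q {{prime⇒nonZero pq}} (subst (q ^ suc k ∣_) (shuffle r m′ q) d))))
  where
  shuffle : ∀ a b c → a * (b * c) ≡ c * (a * b)
  shuffle = solve-∀

n<q^n : ∀ {q} → Prime q → ∀ n → n < q ^ n
n<q^n {q} pq zero = s≤s z≤n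
n<q^n {q} pq (suc n) = begin
  2 + n           ≤⟨ s≤s (n<q^n pq n) ⟩
  1 + q ^ n       ≤⟨ +-monoˡ-≤ (q ^ n) (m^n>0 q {{prime⇒nonZero pq}} n) ⟩
  q ^ n + q ^ n   ≡⟨ cong (q ^ n +_) (sym (+-identityʳ _)) ⟩
  2 * q ^ n       ≤⟨ *-monoˡ-≤ (q ^ n) (nonTrivial⇒n>1 q {{prime⇒nonTrivial pq}}) ⟩
  q * q ^ n ∎
  where open ≤-Reasoning

-- If q = r, then q^(k+1) divides q m exactly when q^k divides m, so the sum shifts by one index and
-- gains a term 1. The top term lost in the shift is zero because m ≤ K < q^K.
valuation-* : ∀ {K q r} m → Prime q → Prime r → 1 ≤ m → m ≤ K →
              valuation K q (r * m) ≡ ⟦ q ≟ r ⟧ + valuation K q m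
valuation-* {zero} m pq pr 1≤m m≤K = contradiction (≤-trans 1≤m m≤K) λ ()
valuation-* {suc K} {q} {r} m pq pr 1≤m m≤K with q ≟ r
... | no q≢r = ∑-cong (λ k → ⟦⟧-⇔ (q ^ k ∣? r * m) (q ^ k ∣? m) (q^k∣rm⇒q^k∣m pq pr q≢r k m) (∣n⇒∣m*n r)) (suc K)
... | yes refl = begin
  ∑ (λ k → ⟦ q ^ k ∣? q * m ⟧) (suc K)                     ≡⟨ ∑-head _ K ⟩
  ⟦ q ^ 1 ∣? q * m ⟧ + ∑ (λ k → ⟦ q ^ suc k ∣? q * m ⟧) K  ≡⟨ cong₂ _+_
      (⟦⟧-yes (q ^ 1 ∣? q * m) (subst (_∣ q * m) (sym (*-identityʳ q)) (m∣m*n m)))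
      (∑-cong (λ k → ⟦⟧-⇔ (q ^ suc k ∣? q * m) (q ^ k ∣? m) (*-cancelˡ-∣ q) (*-monoʳ-∣ q)) K) ⟩
  1 + ∑ (λ k → ⟦ q ^ k ∣? m ⟧) K                           ≡⟨ cong suc (sym (+-identityʳ _)) ⟩
  1 + (∑ (λ k → ⟦ q ^ k ∣? m ⟧) K + 0)                     ≡⟨ cong (λ z → 1 + (valuation K q m + z)) (sym (⟦⟧-no (q ^ suc K ∣? m)
      (>⇒∤ {{>-nonZero 1≤m}} (≤-<-trans m≤K (n<q^n pq (suc K)))))) ⟩
  1 + valuation (suc K) q m ∎
  where
  open ≡-Reasoning
  instance
    q≢0 : NonZero q
    q≢0 = prime⇒nonZero pq

valuation-one : ∀ K {q} → Prime q → valuation K q 1 ≡ 0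
valuation-one zero pq = refl
valuation-one (suc K) {q} pq = cong₂ _+_ (valuation-one K pq)
  (⟦⟧-no (q ^ suc K ∣? 1) (>⇒∤ (≤-<-trans (s≤s z≤n) (n<q^n pq (suc K)))))

product-primePowers : ∀ N {ps} → All Prime ps → product ps ≤ N →
                      product ps ≡ primePowers N (λ q → valuation N q (product ps))
product-primePowers N [] _ = sym (trans (primePowers-cong N (λ q pq → valuation-one N pq)) (primePowers-zero N))
product-primePowers N {r ∷ ps} (pr ∷ pps) r*m≤N = begin
  r * m                                                   ≡⟨ cong₂ _*_ (sym (primePowers-single N r pr r≤N)) (product-primePowers N pps m≤N) ⟩
  primePowers N (λ q → ⟦ q ≟ r ⟧) * primePowers N (λ q → valuation N q m) ≡⟨ sym (primePowers-+ N _ _) ⟩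
  primePowers N (λ q → ⟦ q ≟ r ⟧ + valuation N q m)       ≡⟨ primePowers-cong N (λ q pq → sym (valuation-* m pq pr m>0 m≤N)) ⟩
  primePowers N (λ q → valuation N q (r * m)) ∎
  where
  open ≡-Reasoning
  m : ℕ
  m = product ps
  m>0 : 1 ≤ m
  m>0 = productOfPrimes≥1 pps
  r≤N : r ≤ N
  r≤N = ≤-trans (m≤m*n r m {{>-nonZero m>0}}) r*m≤N
  m≤N : m ≤ N
  m≤N = ≤-trans (m≤n*m m r {{prime⇒nonZero pr}}) r*m≤N

n≡primePowers : ∀ N n → suc n ≤ N → suc n ≡ primePowers N (λ q → valuation N q (suc n))
n≡primePowers N n n<N = trans eq (trans
    (product-primePowers N (PrimeFactorisation.factorsPrime fac) (subst (_≤ N) eq n<N))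
    (cong (λ z → primePowers N (λ q → valuation N q z)) (sym eq)))
  where
  fac : PrimeFactorisation (suc n)
  fac = factorise (suc n)
  eq : suc n ≡ product (PrimeFactorisation.factors fac)
  eq = PrimeFactorisation.isFactorisation fac

infixl 7 _÷_

-- Division made total by n ÷ 0 = 0, so that no NonZero instance on q ^ k has to be carried around.
_÷_ : ℕ → ℕ → ℕ
n ÷ zero  = 0
n ÷ suc d = n / suc d

-- Summed over d = q^k, this makes the valuation of n + 1 the increment of `legendre`, so that
-- Legendre's formula follows by induction on n.
÷-suc : ∀ n d → suc n ÷ d ≡ n ÷ d + ⟦ d ∣? suc n ⟧
÷-suc n zero = sym (⟦⟧-no (0 ∣? suc n) (λ d → 1+n≢0 (0∣⇒≡0 d)))
÷-suc n (suc d) with suc d ∣? suc n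
... | yes (divides (suc c) eq) = begin
  suc n / suc d                    ≡⟨ /-congˡ {o = suc d} eq ⟩
  (suc c * suc d) / suc d          ≡⟨ m*n/n≡m (suc c) (suc d) ⟩
  suc c                            ≡⟨ +-comm 1 c ⟩
  c + 1                            ≡⟨ cong (_+ 1) (sym lower) ⟩
  n / suc d + 1 ∎
  where
  open ≡-Reasoning
  lower : n / suc d ≡ c
  lower = begin
    n / suc d                       ≡⟨ /-congˡ {o = suc d} (suc-injective eq) ⟩
    (d + c * suc d) / suc d         ≡⟨ +-distrib-/-∣ʳ d (n∣m*n c) ⟩
    d / suc d + c * suc d / suc d   ≡⟨ cong₂ _+_ (m<n⇒m/n≡0 {d} {suc d} ≤-refl) (m*n/n≡m c (suc d)) ⟩
    c ∎
... | no ¬div with suc n % suc d in eq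
...   | zero  = contradiction (m%n≡0⇒n∣m (suc n) (suc d) eq) ¬div
...   | suc r = trans (sym lower) (sym (+-identityʳ _))
  where
  open ≡-Reasoning
  c : ℕ
  c = suc n / suc d
  lower : n / suc d ≡ c
  lower = begin
    n / suc d                       ≡⟨ /-congˡ {o = suc d} (suc-injective (trans (m≡m%n+[m/n]*n (suc n) (suc d)) (cong (_+ c * suc d) eq))) ⟩
    (r + c * suc d) / suc d         ≡⟨ +-distrib-/-∣ʳ r (n∣m*n c) ⟩
    r / suc d + c * suc d / suc d   ≡⟨ cong₂ _+_ (m<n⇒m/n≡0 {r} {suc d} (<-trans ≤-refl (subst (_< suc d) eq (m%n<n (suc n) (suc d))))) (m*n/n≡m c (suc d)) ⟩
    c ∎

÷-/-comm : ∀ n d k .{{_ : NonZero k}} → (n / k) ÷ d ≡ (n ÷ d) / k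
÷-/-comm n zero k    = sym (0/n≡0 k)
÷-/-comm n (suc d) k = begin
  n / k / suc d      ≡⟨ m/n/o≡m/[n*o] n k (suc d) ⟩
  n / (k * suc d)    ≡⟨ /-congʳ {{m*n≢0 k (suc d)}} {{m*n≢0 (suc d) k}} (*-comm k (suc d)) ⟩
  _/_ n (suc d * k) {{m*n≢0 (suc d) k}}    ≡⟨ sym (m/n/o≡m/[n*o] n (suc d) k) ⟩
  n / suc d / k ∎
  where
  open ≡-Reasoning
  instance
    _ : NonZero (k * suc d)
    _ = m*n≢0 k (suc d)
    _ : NonZero (suc d * k)
    _ = m*n≢0 (suc d) k

legendre : ℕ → ℕ → ℕ → ℕ
legendre K n q = ∑ (λ k → n ÷ q ^ k) K

-- Abstract, since unfolding (30 * suc n) ! during conversion checking is prohibitively expensive.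
abstract
  factorial : ℕ → ℕ
  factorial n = n !

  factorial-zero : factorial 0 ≡ 1
  factorial-zero = refl

  factorial-suc : ∀ n → factorial (suc n) ≡ suc n * factorial n
  factorial-suc n = refl

  factorial≢0 : ∀ n → NonZero (factorial n)
  factorial≢0 n = n !≢0

factorial-primePowers : ∀ N n → n ≤ N → factorial n ≡ primePowers N (legendre N n)
factorial-primePowers N zero _ = trans factorial-zero (sym (trans (primePowers-cong N (λ q _ → allZero N q)) (primePowers-zero N)))
  where
  0÷ : ∀ d → 0 ÷ d ≡ 0
  0÷ zero    = refl
  0÷ (suc d) = 0/n≡0 (suc d)
  allZero : ∀ K q → legendre K 0 q ≡ 0
  allZero zero    q = refl
  allZero (suc K) q = cong₂ _+_ (allZero K q) (0÷ (q ^ suc K))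
factorial-primePowers N (suc n) n<N = begin
  factorial (suc n)                                   ≡⟨ factorial-suc n ⟩
  suc n * factorial n                                 ≡⟨ *-comm (suc n) (factorial n) ⟩
  factorial n * suc n                                         ≡⟨ cong₂ _*_ (factorial-primePowers N n (<⇒≤ n<N)) (n≡primePowers N n n<N) ⟩
  primePowers N (legendre N n) * primePowers N (λ q → valuation N q (suc n)) ≡⟨ sym (primePowers-+ N _ _) ⟩
  primePowers N (λ q → legendre N n q + valuation N q (suc n)) ≡⟨ primePowers-cong N (λ q _ →
      trans (sym (∑-+ _ _ N)) (∑-cong (λ k → sym (÷-suc n (q ^ k))) N)) ⟩
  primePowers N (legendre N (suc n)) ∎
  where open ≡-Reasoning

-- Chebyshev's weight: it depends only on m mod 30, and the truncated subtraction never truncates.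
χ : ℕ → ℕ
χ m = (m + m / 30) ∸ (m / 2 + m / 3 + m / 5)

χ-residues : ∀ {r} → r < 30 → r / 2 + r / 3 + r / 5 ≤ r × r ≤ 1 + (r / 2 + r / 3 + r / 5)
χ-residues = toWitness {a? = allUpTo? (λ r → (r / 2 + r / 3 + r / 5 ≤? r) ×-dec (r ≤? 1 + (r / 2 + r / 3 + r / 5))) 30} _

-- Adding 30 to m adds 31 to either side, because 15 + 10 + 6 = 30 + 1. Hence the thirty residues
-- decide.
χ-bounds : ∀ m → m / 2 + m / 3 + m / 5 ≤ m + m / 30 × m + m / 30 ≤ 1 + (m / 2 + m / 3 + m / 5)
χ-bounds m = subst₂ _≤_ (sym thirds) (sym whole) (+-monoˡ-≤ (31 * t) (proj₁ res))
           , subst₂ _≤_ (sym whole) (cong suc (sym thirds)) (+-monoˡ-≤ (31 * t) (proj₂ res))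
  where
  r t : ℕ
  r = m % 30
  t = m / 30
  res : r / 2 + r / 3 + r / 5 ≤ r × r ≤ 1 + (r / 2 + r / 3 + r / 5)
  res = χ-residues (m%n<n m 30)
  split : ∀ d e .{{_ : NonZero d}} → e * d ≡ 30 → m / d ≡ r / d + t * e
  split d e eq = begin
    m / d                       ≡⟨ /-congˡ {o = d} (m≡m%n+[m/n]*n m 30) ⟩
    (r + t * 30) / d            ≡⟨ /-congˡ {o = d} (cong (r +_) (trans (cong (t *_) (sym eq)) (sym (*-assoc t e d)))) ⟩
    (r + t * e * d) / d         ≡⟨ +-distrib-/-∣ʳ r (n∣m*n (t * e)) ⟩
    r / d + t * e * d / d       ≡⟨ cong (r / d +_) (m*n/n≡m (t * e) d) ⟩
    r / d + t * e ∎
    where open ≡-Reasoning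
  whole : m + m / 30 ≡ r + 31 * t
  whole = trans (cong (_+ t) (m≡m%n+[m/n]*n m 30)) (lemma r t)
    where
    lemma : ∀ a b → a + b * 30 + b ≡ a + 31 * b
    lemma = solve-∀
  thirds : m / 2 + m / 3 + m / 5 ≡ (r / 2 + r / 3 + r / 5) + 31 * t
  thirds = trans (cong₂ _+_ (cong₂ _+_ (split 2 15 refl) (split 3 10 refl)) (split 5 6 refl)) (lemma (r / 2) (r / 3) (r / 5) t)
    where
    lemma : ∀ a b c t → a + t * 15 + (b + t * 10) + (c + t * 6) ≡ (a + b + c) + 31 * t
    lemma = solve-∀

χ-identity : ∀ m → χ m + (m / 2 + m / 3 + m / 5) ≡ m + m / 30
χ-identity m = m∸n+n≡m (proj₁ (χ-bounds m))

χ≤1 : ∀ m → χ m ≤ 1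
χ≤1 m = m≤n+o⇒m∸n≤o (m + m / 30) (m / 2 + m / 3 + m / 5) (subst (m + m / 30 ≤_) (+-comm 1 _) (proj₂ (χ-bounds m)))

-- The values 1 to 5 are those of ⌊N/q⌋ for N/6 < q ≤ N. So every prime in (5n, 30n] has a positive
-- exponent in Chebyshev's quotient, which gives `primorial-step`.
χ≡1 : ∀ m → 1 ≤ m → m ≤ 5 → χ m ≡ 1
χ≡1 (suc m) _ (s≤s m≤4) = toWitness {a? = allUpTo? (λ i → χ (suc i) ≟ 1) 5} _ (s≤s m≤4)

-- Chebyshev's quotient and its prime factorisation

chebyshevExponent : ℕ → ℕ → ℕ
chebyshevExponent N q = ∑ (λ k → χ (N ÷ q ^ k)) N

-- Defined by its factorisation, which makes integrality automatic and leaves the exponents open to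
-- inspection; `chebyshevQuotient-*` identifies it with the quotient of factorials.
chebyshevQuotient : ℕ → ℕ
chebyshevQuotient n = primePowers (30 * n) (chebyshevExponent (30 * n))

numerator denominator : ℕ → ℕ
numerator   n = factorial (30 * n) * factorial n
denominator n = factorial (15 * n) * factorial (10 * n) * factorial (6 * n)

chebyshevQuotient-* : ∀ n → chebyshevQuotient n * denominator n ≡ numerator n
chebyshevQuotient-* n = begin
  chebyshevQuotient n * denominator n
    ≡⟨ cong (chebyshevQuotient n *_) (cong₂ _*_ (cong₂ _*_ (fact 15 (15≤ n)) (fact 10 (10≤ n))) (fact 6 (6≤ n))) ⟩
  PP cheb * (PP (leg 15) * PP (leg 10) * PP (leg 6))
    ≡⟨ cong (PP cheb *_) (trans (cong (_* PP (leg 6)) (sym (primePowers-+ N _ _))) (sym (primePowers-+ N _ _))) ⟩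
  PP cheb * PP (λ q → leg 15 q + leg 10 q + leg 6 q)
    ≡⟨ sym (primePowers-+ N _ _) ⟩
  PP (λ q → cheb q + (leg 15 q + leg 10 q + leg 6 q))
    ≡⟨ primePowers-cong N (λ q _ → exponents q) ⟩
  PP (λ q → legendre N N q + legendre N n q)
    ≡⟨ primePowers-+ N _ _ ⟩
  PP (legendre N N) * PP (legendre N n)
    ≡⟨ sym (cong₂ _*_ (factorial-primePowers N N ≤-refl) (factorial-primePowers N n (m≤n*m n 30))) ⟩
  numerator n ∎
  where
  open ≡-Reasoning
  N : ℕ
  N = 30 * n
  PP : (ℕ → ℕ) → ℕ
  PP = primePowers N
  cheb : ℕ → ℕ
  cheb = chebyshevExponent N
  leg : ℕ → ℕ → ℕ
  leg a = legendre N (a * n)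
  15≤ : ∀ n → 15 * n ≤ 30 * n
  15≤ n = *-monoˡ-≤ n (from-yes (15 ≤? 30))
  10≤ : ∀ n → 10 * n ≤ 30 * n
  10≤ n = *-monoˡ-≤ n (from-yes (10 ≤? 30))
  6≤ : ∀ n → 6 * n ≤ 30 * n
  6≤ n = *-monoˡ-≤ n (from-yes (6 ≤? 30))
  fact : ∀ a → a * n ≤ N → factorial (a * n) ≡ PP (leg a)
  fact a a*n≤N = factorial-primePowers N (a * n) a*n≤N
  -- Since a n = N / e, nested floors commute, and each Legendre term becomes a function of the
  -- single integer m = N ÷ d. There `χ-identity` applies term by term.
  scaled : ∀ a e .{{_ : NonZero e}} → a * e ≡ 30 → ∀ d → (a * n) ÷ d ≡ (N ÷ d) / e
  scaled a e eq d = trans (cong (_÷ d) (sym N/e)) (÷-/-comm N d e)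
    where
    N/e : N / e ≡ a * n
    N/e = trans (/-congˡ {o = e} (trans (cong (_* n) (sym eq)) (shuffle a e n))) (m*n/n≡m (a * n) e)
      where
      shuffle : ∀ a e n → a * e * n ≡ a * n * e
      shuffle = solve-∀
  exponents : ∀ q → cheb q + (leg 15 q + leg 10 q + leg 6 q) ≡ legendre N N q + legendre N n q
  exponents q = begin
    cheb q + (leg 15 q + leg 10 q + leg 6 q)
      ≡⟨ cong (cheb q +_) (trans (cong (_+ leg 6 q) (sym (∑-+ _ _ N))) (sym (∑-+ _ _ N))) ⟩
    cheb q + ∑ (λ k → (15 * n) ÷ q ^ k + (10 * n) ÷ q ^ k + (6 * n) ÷ q ^ k) N
      ≡⟨ sym (∑-+ _ _ N) ⟩
    ∑ (λ k → χ (N ÷ q ^ k) + ((15 * n) ÷ q ^ k + (10 * n) ÷ q ^ k + (6 * n) ÷ q ^ k)) N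
      ≡⟨ ∑-cong (λ k → termwise (q ^ k)) N ⟩
    ∑ (λ k → N ÷ q ^ k + n ÷ q ^ k) N
      ≡⟨ ∑-+ _ _ N ⟩
    legendre N N q + legendre N n q ∎
    where
    termwise : ∀ d → χ (N ÷ d) + ((15 * n) ÷ d + (10 * n) ÷ d + (6 * n) ÷ d) ≡ N ÷ d + n ÷ d
    termwise d = begin
      χ (N ÷ d) + ((15 * n) ÷ d + (10 * n) ÷ d + (6 * n) ÷ d)
        ≡⟨ cong (χ (N ÷ d) +_) (cong₂ _+_ (cong₂ _+_ (scaled 15 2 refl d) (scaled 10 3 refl d)) (scaled 6 5 refl d)) ⟩
      χ (N ÷ d) + ((N ÷ d) / 2 + (N ÷ d) / 3 + (N ÷ d) / 5)
        ≡⟨ χ-identity (N ÷ d) ⟩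
      N ÷ d + (N ÷ d) / 30
        ≡⟨ cong (N ÷ d +_) (sym (trans (cong (_÷ d) (sym (*-identityˡ n))) (scaled 1 30 refl d))) ⟩
      N ÷ d + n ÷ d ∎

-- Growth of the quotient

abstract
  shifted : ℕ → List ℕ → ℕ
  shifted z is = product (map (_+ z) is)

  shifted-[] : ∀ z → shifted z [] ≡ 1
  shifted-[] z = refl

  shifted-∷ : ∀ z i is → shifted z (i ∷ is) ≡ (i + z) * shifted z is
  shifted-∷ z i is = refl

  shifted-++ : ∀ z is js → shifted z (is ++ js) ≡ shifted z is * shifted z js
  shifted-++ z is js = trans (cong product (map-++ (_+ z) is js)) (product-++ (map (_+ z) is) _)

  shifted-scale : ∀ c y is → c ^ length is * shifted y is ≡ shifted (c * y) (map (c *_) is)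
  shifted-scale c y []       = refl
  shifted-scale c y (i ∷ is) = begin
    c * c ^ length is * ((i + y) * shifted y is)     ≡⟨ shuffle c (c ^ length is) i y (shifted y is) ⟩
    (c * i + c * y) * (c ^ length is * shifted y is) ≡⟨ cong ((c * i + c * y) *_) (shifted-scale c y is) ⟩
    (c * i + c * y) * shifted (c * y) (map (c *_) is) ∎
    where
    open ≡-Reasoning
    shuffle : ∀ c p i y s → c * p * ((i + y) * s) ≡ (c * i + c * y) * (p * s)
    shuffle = solve-∀

  shifted-mono : ∀ z {is js} → Pointwise _≤_ is js → shifted z is ≤ shifted z js
  shifted-mono z []       = ≤-refl
  shifted-mono z (p ∷ ps) = *-mono-≤ (+-monoˡ-≤ z p) (shifted-mono z ps)

  shifted-sort : ∀ z is → shifted z (sort is) ≡ shifted z is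
  shifted-sort z is = product-↭ (↭-map⁺ (_+ z) (sort-↭ is))

-- The step from n to n + 1 multiplies numerator and denominator by products of factors i + 30 n. Sorting the offsets i
-- on both sides makes the comparison of these products termwise.
shifted-mono-sorted : ∀ z {is js} → Pointwise _≤_ (sort is) (sort js) → shifted z is ≤ shifted z js
shifted-mono-sorted z {is} {js} ps = subst₂ _≤_ (shifted-sort z is) (shifted-sort z js) (shifted-mono z ps)

descending : ℕ → List ℕ
descending zero    = []
descending (suc k) = suc k ∷ descending k

factorial-shifted : ∀ k x → factorial (k + x) ≡ shifted x (descending k) * factorial x
factorial-shifted zero    x = sym (trans (cong (_* factorial x) (shifted-[] x)) (*-identityˡ (factorial x)))
factorial-shifted (suc k) x = begin
  factorial (suc (k + x))                                    ≡⟨ factorial-suc (k + x) ⟩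
  (suc k + x) * factorial (k + x)                            ≡⟨ cong ((suc k + x) *_) (factorial-shifted k x) ⟩
  (suc k + x) * (shifted x (descending k) * factorial x)     ≡⟨ sym (*-assoc (suc k + x) (shifted x (descending k)) (factorial x)) ⟩
  (suc k + x) * shifted x (descending k) * factorial x       ≡⟨ cong (_* factorial x) (sym (shifted-∷ x (suc k) (descending k))) ⟩
  shifted x (descending (suc k)) * factorial x ∎
  where open ≡-Reasoning

factorial-step : ∀ a n → factorial (a * suc n) ≡ shifted (a * n) (descending a) * factorial (a * n)
factorial-step a n = trans (cong factorial (*-suc a n)) (factorial-shifted a (a * n))

abstract
  -- This is 30^30 / (15^15 · 10^10 · 6^6), the limit of the ratio of consecutive Chebyshev
  -- quotients.
  C : ℕ
  C = 2 ^ 14 * 3 ^ 9 * 5 ^ 5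

  2^15 3^10 5^6 : ℕ
  2^15 = 2 ^ 15
  3^10 = 3 ^ 10
  5^6  = 5 ^ 6

  2^15≡ : 2^15 ≡ 2 ^ 15
  2^15≡ = refl

  3^10≡ : 3^10 ≡ 3 ^ 10
  3^10≡ = refl

  5^6≡ : 5^6 ≡ 5 ^ 6
  5^6≡ = refl

  30*C : 30 * C ≡ 2^15 * 3^10 * 5^6
  30*C = refl

  4380≤C : 4380 ≤ C
  4380≤C = from-yes (4380 ≤? C)

instance
  C≢0 : NonZero C
  C≢0 = >-nonZero (≤-trans (from-yes (1 ≤? 4380)) 4380≤C)

module _ (n : ℕ) where
  private
    z : ℕ
    z = 30 * n
    -- Scaling the factors of the three denominator products by 2, 3 and 5 uses up 2^15 · 3^10 · 5^6
    -- = 30 C. The 30 left over turns n + 1 in the numerator into 30 + 30 n, so that both sides have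
    -- 31 factors of the form i + 30 n.
    multiples : List ℕ
    multiples = map (2 *_) (descending 15) ++ map (3 *_) (descending 10) ++ map (5 *_) (descending 6)

  numeratorRatio denominatorRatio : ℕ
  numeratorRatio   = shifted z (descending 30) * suc n
  denominatorRatio = shifted (15 * n) (descending 15) * shifted (10 * n) (descending 10) * shifted (6 * n) (descending 6)

  numerator-suc : numerator (suc n) ≡ numeratorRatio * numerator n
  numerator-suc = trans (cong₂ _*_ (factorial-step 30 n) (factorial-suc n)) (shuffle (shifted z (descending 30)) (factorial z) (suc n) (factorial n))
    where
    shuffle : ∀ a b c d → a * b * (c * d) ≡ a * c * (b * d)
    shuffle = solve-∀

  denominator-suc : denominator (suc n) ≡ denominatorRatio * denominator n
  denominator-suc = trans (cong₂ _*_ (cong₂ _*_ (factorial-step 15 n) (factorial-step 10 n)) (factorial-step 6 n))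
    (shuffle (shifted (15 * n) (descending 15)) (factorial (15 * n)) (shifted (10 * n) (descending 10)) (factorial (10 * n)) (shifted (6 * n) (descending 6)) (factorial (6 * n)))
    where
    shuffle : ∀ a b c d e f → a * b * (c * d) * (e * f) ≡ a * c * e * (b * d * f)
    shuffle = solve-∀

  private
    numeratorRatio-shifted : 30 * numeratorRatio ≡ shifted z (30 ∷ descending 30)
    numeratorRatio-shifted = trans (shuffle (shifted z (descending 30)) n) (sym (shifted-∷ z 30 (descending 30)))
      where
      shuffle : ∀ a n → 30 * (a * suc n) ≡ (30 + 30 * n) * a
      shuffle = solve-∀

    denominatorRatio-shifted : 30 * (C * denominatorRatio) ≡ shifted z multiples
    denominatorRatio-shifted = begin
      30 * (C * denominatorRatio) ≡⟨ sym (*-assoc 30 C _) ⟩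
      30 * C * denominatorRatio ≡⟨ cong (_* denominatorRatio) 30*C ⟩
      2^15 * 3^10 * 5^6 * denominatorRatio ≡⟨ shuffle (2^15) (3^10) (5^6)
         (shifted (15 * n) (descending 15)) (shifted (10 * n) (descending 10)) (shifted (6 * n) (descending 6)) ⟩
      2^15 * shifted (15 * n) (descending 15) * (3^10 * shifted (10 * n) (descending 10) * (5^6 * shifted (6 * n) (descending 6)))
        ≡⟨ cong₂ _*_ (scale 2 15 refl 2^15≡) (cong₂ _*_ (scale 3 10 refl 3^10≡) (scale 5 6 refl 5^6≡)) ⟩
      shifted z (map (2 *_) (descending 15)) * (shifted z (map (3 *_) (descending 10)) * shifted z (map (5 *_) (descending 6)))
        ≡⟨ cong (shifted z (map (2 *_) (descending 15)) *_) (sym (shifted-++ z (map (3 *_) (descending 10)) _)) ⟩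
      shifted z (map (2 *_) (descending 15)) * shifted z (map (3 *_) (descending 10) ++ map (5 *_) (descending 6))
        ≡⟨ sym (shifted-++ z (map (2 *_) (descending 15)) _) ⟩
      shifted z multiples ∎
      where
      open ≡-Reasoning
      shuffle : ∀ a b c d e f → a * b * c * (d * e * f) ≡ a * d * (b * e * (c * f))
      shuffle = solve-∀
      length-descending : ∀ k → length (descending k) ≡ k
      length-descending zero    = refl
      length-descending (suc k) = cong suc (length-descending k)
      scale : ∀ c k {w} → c * k ≡ 30 → w ≡ c ^ k → w * shifted (k * n) (descending k) ≡ shifted z (map (c *_) (descending k))
      scale c k eq refl = begin
        c ^ k * shifted (k * n) (descending k)                      ≡⟨ cong (λ l → c ^ l * shifted (k * n) (descending k)) (sym (length-descending k)) ⟩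
        c ^ length (descending k) * shifted (k * n) (descending k)  ≡⟨ shifted-scale c (k * n) (descending k) ⟩
        shifted (c * (k * n)) (map (c *_) (descending k))           ≡⟨ cong (λ w → shifted w (map (c *_) (descending k))) (trans (sym (*-assoc c k n)) (cong (_* n) eq)) ⟩
        shifted z (map (c *_) (descending k)) ∎

  -- The sorted offsets compare termwise because, for x < 30, the numerator has x offsets up to x
  -- and the denominator ⌊x/2⌋ + ⌊x/3⌋ + ⌊x/5⌋, which is at most x. This is the first inequality of
  -- `χ-residues` again.
  numeratorRatio≤ : numeratorRatio ≤ C * denominatorRatio
  numeratorRatio≤ = *-cancelˡ-≤ 30 (subst₂ _≤_ (sym numeratorRatio-shifted) (sym denominatorRatio-shifted)
    (shifted-mono-sorted z {30 ∷ descending 30} {multiples}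
      (from-yes (decidable _≤?_ (sort (30 ∷ descending 30)) (sort multiples)))))

  -- An extra offset 0 in the denominator and an extra 30 in the numerator move the sorted lists
  -- against each other by one place. By the second inequality of `χ-residues` this reverses the
  -- comparison, and the extra factors 30 n and 30 (n + 1) are the whole loss.
  numeratorRatio≥ : n * (C * denominatorRatio) ≤ suc n * numeratorRatio
  numeratorRatio≥ = *-cancelˡ-≤ 30 (*-cancelˡ-≤ 30 (subst₂ _≤_
    (trans (shifted-∷ z 0 multiples) (trans (cong (z *_) (sym denominatorRatio-shifted)) (shuffle n (C * denominatorRatio))))
    (trans (shifted-∷ z 30 (30 ∷ descending 30)) (trans (cong ((30 + z) *_) (sym numeratorRatio-shifted)) (shuffle′ n numeratorRatio)))
    (shifted-mono-sorted z {0 ∷ multiples} {30 ∷ 30 ∷ descending 30}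
      (from-yes (decidable _≤?_ (sort (0 ∷ multiples)) (sort (30 ∷ 30 ∷ descending 30)))))))
    where
    shuffle : ∀ n a → 30 * n * (30 * a) ≡ 30 * (30 * (n * a))
    shuffle = solve-∀
    shuffle′ : ∀ n a → (30 + 30 * n) * (30 * a) ≡ 30 * (30 * (suc n * a))
    shuffle′ = solve-∀

numerator≤ : ∀ n → numerator n ≤ C ^ n * denominator n
numerator≤ zero    = ≤-reflexive (shuffle (factorial 0) factorial-zero)
  where
  shuffle : ∀ f → f ≡ 1 → f * f ≡ 1 * (f * f * f)
  shuffle f refl = refl
numerator≤ (suc n) = begin
  numerator (suc n)                                        ≡⟨ numerator-suc n ⟩
  numeratorRatio n * numerator n                           ≤⟨ *-mono-≤ (numeratorRatio≤ n) (numerator≤ n) ⟩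
  C * denominatorRatio n * (C ^ n * denominator n)         ≡⟨ shuffle C (denominatorRatio n) (C ^ n) (denominator n) ⟩
  C ^ suc n * (denominatorRatio n * denominator n)         ≡⟨ cong (C ^ suc n *_) (sym (denominator-suc n)) ⟩
  C ^ suc n * denominator (suc n) ∎
  where
  open ≤-Reasoning
  shuffle : ∀ a b c d → a * b * (c * d) ≡ a * c * (b * d)
  shuffle = solve-∀

-- The losses (n + 1)/n telescope to a single linear factor. The step from 0 to 1 would give only a
-- trivial bound, so the induction starts at 1, at the price of a factor `C`.
numerator≥ : ∀ n → C ^ suc n * denominator (suc n) ≤ C * (suc n * numerator (suc n))
numerator≥ zero    = begin
  C ^ 1 * denominator 1                        ≤⟨ *-mono-≤ (≤-reflexive (*-identityʳ C)) (m≤n*m (denominator 1) (chebyshevQuotient 1) {{>-nonZero (primePowers>0 30 (chebyshevExponent 30))}}) ⟩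
  C * (chebyshevQuotient 1 * denominator 1)    ≡⟨ cong (C *_) (trans (chebyshevQuotient-* 1) (sym (*-identityˡ (numerator 1)))) ⟩
  C * (1 * numerator 1) ∎
  where open ≤-Reasoning
numerator≥ (suc m) = begin
  C ^ suc n * denominator (suc n)                     ≡⟨ cong (C ^ suc n *_) (denominator-suc n) ⟩
  C ^ suc n * (denominatorRatio n * denominator n)    ≡⟨ shuffle C (C ^ n) (denominatorRatio n) (denominator n) ⟩
  C * denominatorRatio n * (C ^ n * denominator n)    ≤⟨ *-monoʳ-≤ (C * denominatorRatio n) (numerator≥ m) ⟩
  C * denominatorRatio n * (C * (n * numerator n))    ≡⟨ shuffle′ (C * denominatorRatio n) C n (numerator n) ⟩
  n * (C * denominatorRatio n) * (C * numerator n)    ≤⟨ *-monoˡ-≤ (C * numerator n) (numeratorRatio≥ n) ⟩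
  suc n * numeratorRatio n * (C * numerator n)        ≡⟨ shuffle″ (suc n) (numeratorRatio n) C (numerator n) ⟩
  C * (suc n * (numeratorRatio n * numerator n))      ≡⟨ cong (λ w → C * (suc n * w)) (sym (numerator-suc n)) ⟩
  C * (suc n * numerator (suc n)) ∎
  where
  open ≤-Reasoning
  n : ℕ
  n = suc m
  shuffle : ∀ a b c d → a * b * (c * d) ≡ a * c * (b * d)
  shuffle = solve-∀
  shuffle′ : ∀ a b c d → a * (b * (c * d)) ≡ c * a * (b * d)
  shuffle′ = solve-∀
  shuffle″ : ∀ a b c d → a * b * (c * d) ≡ c * (a * (b * d))
  shuffle″ = solve-∀

denominator≢0 : ∀ n → NonZero (denominator n)
denominator≢0 n = m*n≢0 (factorial (15 * n) * factorial (10 * n)) (factorial (6 * n))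
  {{m*n≢0 (factorial (15 * n)) (factorial (10 * n)) {{factorial≢0 (15 * n)}} {{factorial≢0 (10 * n)}}}} {{factorial≢0 (6 * n)}}

chebyshevQuotient≤ : ∀ n → chebyshevQuotient n ≤ C ^ n
chebyshevQuotient≤ n = *-cancelʳ-≤ _ _ (denominator n) {{denominator≢0 n}}
  (subst (_≤ C ^ n * denominator n) (sym (chebyshevQuotient-* n)) (numerator≤ n))

chebyshevQuotient≥ : ∀ n → C ^ suc n ≤ C * (suc n * chebyshevQuotient (suc n))
chebyshevQuotient≥ n = *-cancelʳ-≤ _ _ (denominator (suc n)) {{denominator≢0 (suc n)}}
  (subst (C ^ suc n * denominator (suc n) ≤_) (trans (cong (λ w → C * (suc n * w)) (sym (chebyshevQuotient-* (suc n))))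
    (shuffle C (suc n) (chebyshevQuotient (suc n)) (denominator (suc n)))) (numerator≥ n))
  where
  shuffle : ∀ a b c d → a * (b * (c * d)) ≡ a * (b * c) * d
  shuffle = solve-∀

-- Upper bound for the primorial

∏-const : ∀ c n → ∏ (λ _ → c) n ≡ c ^ n
∏-const c zero    = refl
∏-const c (suc n) = trans (cong (_* c) (∏-const c n)) (*-comm (c ^ n) c)

∏-^ : ∀ c x n → ∏ (λ i → c ^ x i) n ≡ c ^ ∑ x n
∏-^ c x zero    = refl
∏-^ c x (suc n) = trans (cong (_* c ^ x (suc n)) (∏-^ c x n)) (sym (^-distribˡ-+-* c (∑ x n) (x (suc n))))

∑≤n : ∀ f n → (∀ i → f i ≤ 1) → ∑ f n ≤ n
∑≤n f zero    h = z≤n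
∑≤n f (suc n) h = subst (∑ f (suc n) ≤_) (+-comm n 1) (+-mono-≤ (∑≤n f n h) (h (suc n)))

⟦⟧≤1 : ∀ {a} {P : Set a} (d : Dec P) → ⟦ d ⟧ ≤ 1
⟦⟧≤1 (yes _) = ≤-refl
⟦⟧≤1 (no _)  = z≤n

∑-≤-count : ∀ s n → ∑ (λ i → ⟦ i ≤? s ⟧) n ≤ s
∑-≤-count s zero    = z≤n
∑-≤-count s (suc n) with suc n ≤? s
... | yes n<s = ≤-trans (subst (∑ (λ i → ⟦ i ≤? s ⟧) n + 1 ≤_) (+-comm n 1)
                  (+-monoˡ-≤ 1 (∑≤n (λ i → ⟦ i ≤? s ⟧) n (λ i → ⟦⟧≤1 (i ≤? s))))) n<s
... | no _    = subst (_≤ s) (sym (+-identityʳ _)) (∑-≤-count s n)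

primePower-one≤ : ∀ q {c} → 1 ≤ c → q ≤ c → primePower q 1 ≤ c
primePower-one≤ q 1≤c q≤c with prime? q
... | yes _ = subst (_≤ _) (sym (*-identityʳ q)) q≤c
... | no  _ = 1≤c

primorial : ℕ → ℕ
primorial n = primePowers n (λ _ → 1)

primorial-mono : ∀ {m n} → m ≤ n → primorial m ≤ primorial n
primorial-mono {m} {n} m≤n = subst (λ w → primorial m ≤ primorial w) (m+[n∸m]≡n m≤n) (grow (n ∸ m))
  where
  grow : ∀ k → primorial m ≤ primorial (m + k)
  grow zero    = ≤-reflexive (cong primorial (sym (+-identityʳ m)))
  grow (suc k) rewrite +-suc m k =
    ≤-trans (grow k) (m≤m*n (primorial (m + k)) (primePower (suc (m + k)) 1) {{>-nonZero (primePower>0 (suc (m + k)) 1)}})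

primorial-step : ∀ n → primorial (30 * n) ≤ primorial (5 * n) * chebyshevQuotient n
primorial-step n = begin
  primorial N                                               ≤⟨ ∏-mono N (λ q 1≤q q≤N → primePower-mono q (λ pq → exponent q pq q≤N)) ⟩
  primePowers N (λ q → ⟦ q ≤? M ⟧ + chebyshevExponent N q)  ≡⟨ primePowers-+ N (λ q → ⟦ q ≤? M ⟧) (chebyshevExponent N) ⟩
  primePowers N (λ q → ⟦ q ≤? M ⟧) * chebyshevQuotient n    ≡⟨ cong (_* chebyshevQuotient n) truncate ⟩
  primorial M * chebyshevQuotient n ∎
  where
  open ≤-Reasoning
  N M : ℕ
  N = 30 * n
  M = 5 * n
  truncate : primePowers N (λ q → ⟦ q ≤? M ⟧) ≡ primorial M
  truncate = trans (cong (λ w → primePowers w (λ q → ⟦ q ≤? M ⟧)) (*-distribʳ-+ n 5 25))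
    (trans (∏-extend _ M (25 * n) (λ q M<q → trans (cong (primePower q) (⟦⟧-no (q ≤? M) (<⇒≱ M<q))) (primePower-zero q)))
           (∏-cong M (λ q _ q≤M → cong (primePower q) (⟦⟧-yes (q ≤? M) q≤M))))
  1≤∑ : ∀ K f → 1 ≤ K → f 1 ≡ 1 → 1 ≤ ∑ f K
  1≤∑ (suc K) f _ eq = subst (1 ≤_) (sym (trans (∑-head f K) (cong (_+ ∑ (f ∘ suc) K) eq))) (s≤s z≤n)
  exponent : ∀ q → Prime q → q ≤ N → 1 ≤ ⟦ q ≤? M ⟧ + chebyshevExponent N q
  exponent q pq q≤N with q ≤? M
  ... | yes _  = s≤s z≤n
  ... | no q≰M = 1≤∑ N _ (≤-trans (>-nonZero⁻¹ q {{prime⇒nonZero pq}}) q≤N)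
                   (trans (cong (λ w → χ (N ÷ w)) (*-identityʳ q)) (first q q≤N (≰⇒> q≰M) (>-nonZero⁻¹ q {{prime⇒nonZero pq}})))
    where
    first : ∀ q → q ≤ N → M < q → 1 ≤ q → χ (N ÷ q) ≡ 1
    first (suc q) q≤N M<q _ = χ≡1 (N / suc q) (m≥n⇒m/n>0 q≤N)
      (≤-pred (m<n*o⇒m/o<n {N} {6} {suc q} (subst (_< 6 * suc q) (sym (*-assoc 6 5 n)) (*-monoʳ-< 6 M<q))))

-- The trivial bound C ^ (30 n) on the primorial of 30 n, raised to the power 100, costs this exponent for n ≤ 146.
abstract
  β : ℕ
  β = 438000

  30*146*100≤β : 30 * 146 * 100 ≤ β
  30*146*100≤β = ≤-refl

  error≤ : 121 * 181 + 100 * 100 + 100 * β ≤ 44 * 2 ^ 20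
  error≤ = from-yes (121 * 181 + 100 * 100 + 100 * β ≤? 44 * 2 ^ 20)

primorial≤-small : ∀ n → n ≤ 146 → primorial (30 * n) ^ 100 ≤ C ^ (121 * n + β)
primorial≤-small n n≤146 = begin
  primorial (30 * n) ^ 100  ≤⟨ ^-monoˡ-≤ 100 (subst (primorial (30 * n) ≤_) (∏-const C (30 * n))
      (∏-mono (30 * n) (λ q _ q≤ → primePower-one≤ q (>-nonZero⁻¹ C) (≤-trans q≤ (≤-trans (*-monoʳ-≤ 30 n≤146) 4380≤C))))) ⟩
  (C ^ (30 * n)) ^ 100      ≡⟨ ^-*-assoc C (30 * n) 100 ⟩
  C ^ (30 * n * 100)        ≤⟨ ^-monoʳ-≤ C (≤-trans (≤-trans (*-monoˡ-≤ 100 (*-monoʳ-≤ 30 n≤146)) 30*146*100≤β) (m≤n+m β (121 * n))) ⟩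
  C ^ (121 * n + β) ∎
  where open ≤-Reasoning

^-distribʳ-* : ∀ a b k → (a * b) ^ k ≡ a ^ k * b ^ k
^-distribʳ-* a b zero    = refl
^-distribʳ-* a b (suc k) = trans (cong (a * b *_) (^-distribʳ-* a b k)) (shuffle a b (a ^ k) (b ^ k))
  where
  shuffle : ∀ a b c d → a * b * (c * d) ≡ a * c * (b * d)
  shuffle = solve-∀

-- The recursion n ↦ n/6 alone would give the exponent 6/5; the excess 121/100 absorbs the rounding as soon as n > 146.
primorial≤ : ∀ n → primorial (30 * n) ^ 100 ≤ C ^ (121 * n + β)
primorial≤ = <-rec _ step
  where
  open ≤-Reasoning
  step : ∀ n → (∀ {m} → m < n → primorial (30 * m) ^ 100 ≤ C ^ (121 * m + β)) → primorial (30 * n) ^ 100 ≤ C ^ (121 * n + β)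
  step n rec with n ≤? 146
  ... | yes n≤146 = primorial≤-small n n≤146
  ... | no n≰146 = begin
    primorial (30 * n) ^ 100                            ≤⟨ ^-monoˡ-≤ 100 (primorial-step n) ⟩
    (primorial (5 * n) * chebyshevQuotient n) ^ 100     ≤⟨ ^-monoˡ-≤ 100 (*-mono-≤ (primorial-mono 5n≤30m) (chebyshevQuotient≤ n)) ⟩
    (primorial (30 * m) * C ^ n) ^ 100                  ≡⟨ ^-distribʳ-* (primorial (30 * m)) (C ^ n) 100 ⟩
    primorial (30 * m) ^ 100 * (C ^ n) ^ 100            ≤⟨ *-mono-≤ (rec m<n) (≤-reflexive (^-*-assoc C n 100)) ⟩
    C ^ (121 * m + β) * C ^ (n * 100)                   ≡⟨ sym (^-distribˡ-+-* C (121 * m + β) (n * 100)) ⟩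
    C ^ (121 * m + β + n * 100)                         ≤⟨ ^-monoʳ-≤ C exponent≤ ⟩
    C ^ (121 * n + β) ∎
    where
    t m : ℕ
    t = n / 6
    m = suc t
    n>146 : 146 < n
    n>146 = ≰⇒> n≰146
    6t≤n : t * 6 ≤ n
    6t≤n = m/n*n≤m n 6
    n≤6m : n ≤ m * 6
    n≤6m = begin
      n                 ≡⟨ m≡m%n+[m/n]*n n 6 ⟩
      n % 6 + t * 6     ≤⟨ +-monoˡ-≤ (t * 6) (<⇒≤ (m%n<n n 6)) ⟩
      6 + t * 6 ∎
    5n≤30m : 5 * n ≤ 30 * m
    5n≤30m = begin
      5 * n        ≤⟨ *-monoʳ-≤ 5 n≤6m ⟩
      5 * (m * 6)  ≡⟨ shuffle m ⟩
      30 * m ∎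
      where
      shuffle : ∀ m → 5 * (m * 6) ≡ 30 * m
      shuffle = solve-∀
    m<n : m < n
    m<n = *-cancelʳ-< 6 m n (begin-strict
      6 + t * 6     ≤⟨ +-monoʳ-≤ 6 6t≤n ⟩
      6 + n         <⟨ +-monoˡ-< n (≤-trans (from-yes (7 ≤? 147)) n>146) ⟩
      n + n         ≡⟨ shuffle n ⟩
      n * 2         ≤⟨ *-monoʳ-≤ n (from-yes (2 ≤? 6)) ⟩
      n * 6 ∎)
      where
      shuffle : ∀ n → n + n ≡ n * 2
      shuffle = solve-∀
    exponent≤ : 121 * m + β + n * 100 ≤ 121 * n + β
    exponent≤ = begin
      121 * m + β + n * 100     ≡⟨ shuffle (121 * m) β (n * 100) ⟩
      (121 * m + n * 100) + β   ≤⟨ +-monoˡ-≤ β (*-cancelʳ-≤ _ _ 6 (begin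
        (121 * suc t + n * 100) * 6       ≡⟨ shuffle₁ t n ⟩
        -- Rounding up to m = n / 6 + 1 costs 726 = 6 · 121. As 726 = 121 + 5 + 600 as well, there
        -- is a surplus of 5 n, at least 5 · 147 = 735.
        121 * (t * 6) + 726 + 600 * n     ≤⟨ +-monoˡ-≤ (600 * n) (+-mono-≤ (*-monoʳ-≤ 121 6t≤n) (≤-trans (from-yes (726 ≤? 5 * 147)) (*-monoʳ-≤ 5 n>146))) ⟩
        121 * n + 5 * n + 600 * n         ≡⟨ shuffle₂ n ⟩
        121 * n * 6 ∎)) ⟩
      121 * n + β ∎
      where
      shuffle : ∀ a b c → a + b + c ≡ (a + c) + b
      shuffle = solve-∀
      shuffle₁ : ∀ t n → (121 * suc t + n * 100) * 6 ≡ 121 * (t * 6) + 726 + 600 * n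
      shuffle₁ = solve-∀
      shuffle₂ : ∀ n → 121 * n + 5 * n + 600 * n ≡ 121 * n * 6
      shuffle₂ = solve-∀

-- Chebyshev's quotient bounded by the primorial

module _ (N : ℕ) {q : ℕ} (pq : Prime q) where
  private
    instance
      q≢0 : NonZero q
      q≢0 = prime⇒nonZero pq
    e : ℕ → ℕ
    e k = χ (N ÷ q ^ k)
    e≡0 : ∀ k → N < q ^ k → e k ≡ 0
    e≡0 k N<q^k = cong χ (N÷d≡0 (q ^ k) N<q^k)
      where
      N÷d≡0 : ∀ d → N < d → N ÷ d ≡ 0
      N÷d≡0 (suc d) N<d = m<n⇒m/n≡0 N<d

  -- Terms with q^k > N vanish and all others are at most 1, so the exponent does not exceed the
  -- largest k with q^k ≤ N. Lowering the cutoff `K` until q^K ≤ N avoids naming that k.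
  ^-partialExponent≤ : 1 ≤ N → ∀ K → q ^ ∑ e K ≤ N
  ^-partialExponent≤ 1≤N zero    = 1≤N
  ^-partialExponent≤ 1≤N (suc K) with q ^ suc K ≤? N
  ... | yes q^K≤N = ≤-trans (^-monoʳ-≤ q (∑≤n e (suc K) (λ k → χ≤1 (N ÷ q ^ k)))) q^K≤N
  ... | no q^K≰N  = subst (λ w → q ^ w ≤ N) (sym (trans (cong (∑ e K +_) (e≡0 (suc K) (≰⇒> q^K≰N))) (+-identityʳ (∑ e K))))
                      (^-partialExponent≤ 1≤N K)

  partialExponent≤1 : N < q * q → ∀ K → ∑ e K ≤ 1
  partialExponent≤1 N<q² zero          = z≤n
  partialExponent≤1 N<q² (suc zero)    = χ≤1 (N ÷ q ^ 1)
  partialExponent≤1 N<q² (suc (suc K)) = subst (_≤ 1) (sym (trans (cong (∑ e (suc K) +_)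
      (e≡0 (2 + K) (<-≤-trans N<q² q²≤))) (+-identityʳ (∑ e (suc K))))) (partialExponent≤1 N<q² (suc K))
    where
    q²≤ : q * q ≤ q ^ (2 + K)
    q²≤ = *-monoʳ-≤ q (m≤m*n q (q ^ K) {{m^n≢0 q K}})

-- A prime above s has exponent at most 1 and is paid for by the primorial. Each of the at most s
-- smaller ones contributes a prime power of size at most 30 n.
chebyshevQuotient≤primorial : ∀ n s → 1 ≤ n → 30 * n < s * s →
                              chebyshevQuotient n ≤ primorial (30 * n) * (30 * n) ^ s
chebyshevQuotient≤primorial n s 1≤n N<s² = begin
  chebyshevQuotient n                                       ≤⟨ ∏-mono N (λ q _ _ → pointwise q) ⟩
  ∏ (λ q → primePower q 1 * N ^ ⟦ q ≤? s ⟧) N               ≡⟨ ∏-* _ _ N ⟩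
  primorial N * ∏ (λ q → N ^ ⟦ q ≤? s ⟧) N                  ≡⟨ cong (primorial N *_) (∏-^ N _ N) ⟩
  primorial N * N ^ ∑ (λ q → ⟦ q ≤? s ⟧) N                  ≤⟨ *-monoʳ-≤ (primorial N) (^-monoʳ-≤ N {{>-nonZero 1≤N}} (∑-≤-count s N)) ⟩
  primorial N * N ^ s ∎
  where
  open ≤-Reasoning
  N : ℕ
  N = 30 * n
  1≤N : 1 ≤ N
  1≤N = ≤-trans 1≤n (m≤n*m n 30)
  pointwise : ∀ q → primePower q (chebyshevExponent N q) ≤ primePower q 1 * N ^ ⟦ q ≤? s ⟧
  pointwise q with q ≤? s
  ... | yes _ = ≤-trans (bound q) (m≤n*m (N ^ 1) (primePower q 1) {{>-nonZero (primePower>0 q 1)}})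
    where
    bound : ∀ q → primePower q (chebyshevExponent N q) ≤ N ^ 1
    bound q rewrite *-identityʳ N with prime? q
    ... | yes pq = ^-partialExponent≤ N pq 1≤N N
    ... | no _   = 1≤N
  ... | no q≰s = subst (primePower q (chebyshevExponent N q) ≤_) (sym (*-identityʳ (primePower q 1)))
      (primePower-mono q (λ pq → partialExponent≤1 N pq (<-trans N<s² (*-mono-< s<q s<q)) N))
    where
    s<q : s < q
    s<q = ≰⇒> q≰s

-- Primes in (l, N]

primesBetween : ℕ → ℕ → List ℕ
primesBetween l zero    = []
primesBetween l (suc N) with l <? suc N | prime? (suc N)
... | yes _ | yes _ = suc N ∷ primesBetween l N
... | yes _ | no  _ = primesBetween l N
... | no  _ | _     = primesBetween l N

primesBetween-∈ : ∀ l N → All (λ q → l < q × q ≤ N × Prime q) (primesBetween l N)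
primesBetween-∈ l zero    = []
primesBetween-∈ l (suc N) with l <? suc N | prime? (suc N)
... | yes l<q | yes pq = (l<q , ≤-refl , pq) ∷ All.map (λ (a , b , c) → a , m≤n⇒m≤1+n b , c) (primesBetween-∈ l N)
... | yes _   | no  _  = All.map (λ (a , b , c) → a , m≤n⇒m≤1+n b , c) (primesBetween-∈ l N)
... | no  _   | _      = All.map (λ (a , b , c) → a , m≤n⇒m≤1+n b , c) (primesBetween-∈ l N)

primesBetween-! : ∀ l N → Unique (primesBetween l N)
primesBetween-! l zero    = []
primesBetween-! l (suc N) with l <? suc N | prime? (suc N)
... | yes _ | yes _ = All.map (λ (_ , q≤N , _) → >⇒≢ (s≤s q≤N)) (primesBetween-∈ l N) ∷ primesBetween-! l N
... | yes _ | no  _ = primesBetween-! l N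
... | no  _ | _     = primesBetween-! l N

-- The bound `M` for the individual primes is separate from `N` so that it stays fixed while `N`
-- runs through the induction.
primorial≤primesBetween : ∀ l N M → 1 ≤ M → N ≤ M → primorial N ≤ primorial l * M ^ length (primesBetween l N)
primorial≤primesBetween l zero    M 1≤M _   = subst (1 ≤_) (sym (*-identityʳ (primorial l))) (primePowers>0 l _)
primorial≤primesBetween l (suc N) M 1≤M N<M with suc N ≤? l
... | yes q≤l = ≤-trans (primorial-mono q≤l) (m≤m*n (primorial l) _ {{m^n≢0 M (length (primesBetween l (suc N))) {{>-nonZero 1≤M}}}})
... | no q≰l = step (primorial≤primesBetween l N M 1≤M (<⇒≤ N<M))
  where
  step : primorial N ≤ primorial l * M ^ length (primesBetween l N) →
         primorial (suc N) ≤ primorial l * M ^ length (primesBetween l (suc N))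
  step ih with l <? suc N | prime? (suc N)
  ... | no l≮q | _     = contradiction (≰⇒> q≰l) l≮q
  ... | yes _  | no  _ = ≤-trans (≤-reflexive (*-identityʳ (primorial N))) ih
  ... | yes _  | yes _ = begin
    primorial N * (suc N) ^ 1                                         ≤⟨ *-mono-≤ ih (subst (_≤ M) (sym (*-identityʳ (suc N))) N<M) ⟩
    primorial l * M ^ length (primesBetween l N) * M                  ≡⟨ shuffle (primorial l) (M ^ length (primesBetween l N)) M ⟩
    primorial l * (M * M ^ length (primesBetween l N)) ∎
    where
    open ≤-Reasoning
    shuffle : ∀ a b c → a * b * c ≡ a * (c * b)
    shuffle = solve-∀

-- Lower bound for the number of primes

^-cancelʳ-≤ : ∀ m a b → 1 < m → m ^ a ≤ m ^ b → a ≤ b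
^-cancelʳ-≤ m a b 1<m le with a ≤? b
... | yes a≤b = a≤b
... | no a≰b  = contradiction le (<⇒≱ (^-monoʳ-< m 1<m (≰⇒> a≰b)))

^≤^ : ∀ {a c} b e → 2 ≤ c → a ≤ 2 ^ b → a ^ e ≤ c ^ (b * e)
^≤^ {a} {c} b e 2≤c a≤2^b = begin
  a ^ e          ≤⟨ ^-monoˡ-≤ e a≤2^b ⟩
  (2 ^ b) ^ e    ≡⟨ ^-*-assoc 2 b e ⟩
  2 ^ (b * e)    ≤⟨ ^-monoˡ-≤ (b * e) 2≤c ⟩
  c ^ (b * e) ∎
  where open ≤-Reasoning

n<30[1+n/30] : ∀ n → n < 30 * suc (n / 30)
n<30[1+n/30] n = begin-strict
  n                           ≡⟨ m≡m%n+[m/n]*n n 30 ⟩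
  n % 30 + n / 30 * 30        <⟨ +-monoˡ-< (n / 30 * 30) (m%n<n n 30) ⟩
  suc (n / 30) * 30           ≡⟨ *-comm (suc (n / 30)) 30 ⟩
  30 * suc (n / 30) ∎
  where open ≤-Reasoning

module _ (l N s L n m : ℕ) (1≤n : 1 ≤ n) (30n≤N : 30 * n ≤ N) (l≤30m : l ≤ 30 * m)
         (N<s² : N < s * s) (N<2^ : N < 2 ^ suc L) where
  private
    k j : ℕ
    k = length (primesBetween l N)
    -- Factors of size N: one for each of the k primes in (l, N], s for the small primes, and one
    -- for the linear factor n in `chebyshevQuotient≥`.
    j = suc (k + s)
    n≤N : n ≤ N
    n≤N = ≤-trans (m≤n*m n 30) 30n≤N
    1<C : 1 < C
    1<C = ≤-trans (from-yes (2 ≤? 4380)) 4380≤C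
    primorialBound : primorial (30 * n) ≤ primorial (30 * m) * N ^ k
    primorialBound = ≤-trans (primorial-mono 30n≤N) (≤-trans (primorial≤primesBetween l N N (≤-trans 1≤n n≤N) ≤-refl)
      (*-monoˡ-≤ (N ^ k) (primorial-mono l≤30m)))

    lower : ∀ n → 1 ≤ n → C ^ n ≤ C * (n * chebyshevQuotient n)
    lower (suc n) _ = chebyshevQuotient≥ n

    C^n≤ : C ^ n ≤ C * (primorial (30 * m) * N ^ suc (k + s))
    C^n≤ = begin
      C ^ n                                               ≤⟨ lower n 1≤n ⟩
      C * (n * chebyshevQuotient n)                       ≤⟨ *-monoʳ-≤ C (*-mono-≤ n≤N (chebyshevQuotient≤primorial n s 1≤n (≤-<-trans 30n≤N N<s²))) ⟩
      C * (N * (primorial (30 * n) * (30 * n) ^ s))       ≤⟨ *-monoʳ-≤ C (*-monoʳ-≤ N (*-mono-≤ primorialBound (^-monoˡ-≤ s 30n≤N))) ⟩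
      C * (N * (primorial (30 * m) * N ^ k * N ^ s))      ≡⟨ shuffle C N (primorial (30 * m)) (N ^ k) (N ^ s) ⟩
      C * (primorial (30 * m) * (N * (N ^ k * N ^ s)))    ≡⟨ cong (λ w → C * (primorial (30 * m) * (N * w))) (sym (^-distribˡ-+-* N k s)) ⟩
      C * (primorial (30 * m) * N ^ suc (k + s)) ∎
      where
      open ≤-Reasoning
      shuffle : ∀ a b c d e → a * (b * (c * d * e)) ≡ a * (c * (b * (d * e)))
      shuffle = solve-∀

    -- Passing from base 2 to base `C` is wasteful, but it costs only a constant factor in the
    -- number of primes.
    N^≤ : (N ^ j) ^ 100 ≤ C ^ (suc L * (j * 100))
    N^≤ = ≤-trans (≤-reflexive (^-*-assoc N j 100)) (^≤^ (suc L) (j * 100) 1<C (<⇒≤ N<2^))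

    exponents : n * 100 ≤ 100 + (121 * m + β + suc L * (j * 100))
    exponents = ^-cancelʳ-≤ C _ _ 1<C (begin
      C ^ (n * 100)                                                  ≡⟨ sym (^-*-assoc C n 100) ⟩
      (C ^ n) ^ 100                                                  ≤⟨ ^-monoˡ-≤ 100 C^n≤ ⟩
      (C * (primorial (30 * m) * N ^ j)) ^ 100                       ≡⟨ ^-distribʳ-* C (primorial (30 * m) * N ^ j) 100 ⟩
      C ^ 100 * (primorial (30 * m) * N ^ j) ^ 100                   ≡⟨ cong (C ^ 100 *_) (^-distribʳ-* (primorial (30 * m)) (N ^ j) 100) ⟩
      C ^ 100 * (primorial (30 * m) ^ 100 * (N ^ j) ^ 100)           ≤⟨ *-monoʳ-≤ (C ^ 100) (*-mono-≤ (primorial≤ m) N^≤) ⟩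
      C ^ 100 * (C ^ (121 * m + β) * C ^ (suc L * (j * 100)))        ≡⟨ cong (C ^ 100 *_) (sym (^-distribˡ-+-* C (121 * m + β) (suc L * (j * 100)))) ⟩
      C ^ 100 * C ^ (121 * m + β + suc L * (j * 100))                ≡⟨ sym (^-distribˡ-+-* C 100 (121 * m + β + suc L * (j * 100))) ⟩
      C ^ (100 + (121 * m + β + suc L * (j * 100))) ∎)
      where open ≤-Reasoning

  -- Here 0.81 meets 1.21: 121 · 81 = 9801 falls short of 100 · 100 by 199, and this difference
  -- forces primes into (l, N].
  primesBetween-bound : 100 * m ≤ 81 * n + 181 →
    199 * n ≤ 100 * 100 * (suc L * k) + (100 * 100 * (suc L * suc s) + (121 * 181 + 100 * 100 + 100 * β))
  primesBetween-bound 100m≤ = +-cancelˡ-≤ (9801 * n) _ _ (begin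
    9801 * n + 199 * n                                         ≡⟨ shuffle₁ n ⟩
    100 * (n * 100)                                            ≤⟨ *-monoʳ-≤ 100 exponents ⟩
    100 * (100 + (121 * m + β + suc L * (j * 100)))            ≡⟨ shuffle₂ 100 m β L k s ⟩
    121 * (100 * m) + (100 * 100 + (100 * 100 * (suc L * k) + (100 * 100 * (suc L * suc s) + 100 * β)))
                                                               ≤⟨ +-monoˡ-≤ _ (*-monoʳ-≤ 121 100m≤) ⟩
    121 * (81 * n + 181) + (100 * 100 + (100 * 100 * (suc L * k) + (100 * 100 * (suc L * suc s) + 100 * β)))
                                                               ≡⟨ shuffle₃ n 181 (100 * 100) (100 * 100 * (suc L * k)) (100 * 100 * (suc L * suc s)) (100 * β) ⟩
    9801 * n + (100 * 100 * (suc L * k) + (100 * 100 * (suc L * suc s) + (121 * 181 + 100 * 100 + 100 * β))) ∎)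
    where
    open ≤-Reasoning
    shuffle₁ : ∀ n → 9801 * n + 199 * n ≡ 100 * (n * 100)
    shuffle₁ = solve-∀
    shuffle₂ : ∀ h m b L k s → h * (h + (121 * m + b + suc L * (suc (k + s) * h)))
               ≡ 121 * (h * m) + (h * h + (h * h * (suc L * k) + (h * h * (suc L * suc s) + h * b)))
    shuffle₂ = solve-∀
    shuffle₃ : ∀ n c d x y z → 121 * (81 * n + c) + (d + (x + (y + z))) ≡ 9801 * n + (x + (y + (121 * c + d + z)))
    shuffle₃ = solve-∀

binaryLength : ∀ n → 1 ≤ n → ∃[ L ] (2 ^ L ≤ n × n < 2 ^ suc L)
binaryLength (suc zero)    _ = 0 , s≤s z≤n , s≤s (s≤s z≤n)
binaryLength (suc (suc n)) _ with binaryLength (suc n) (s≤s z≤n)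
... | L , lo , hi with suc (suc n) <? 2 ^ suc L
...   | yes n<2^ = L , m≤n⇒m≤1+n lo , n<2^
...   | no n≮2^  = suc L , ≮⇒≥ n≮2^ , ≤-<-trans hi (^-monoʳ-< 2 (s≤s (s≤s z≤n)) (n<1+n (suc L)))

-- An affine f satisfies f(h + 1) + f(h - 1) = 2 f(h), so a nonnegative one at most doubles from h
-- to h + 1, as the power of two does.
linear≤exponential : ∀ i → 100 * 100 * (6 * suc (i + 20)) + 44 ≤ 3 * 2 ^ (i + 20)
linear≤exponential zero    = from-yes (100 * 100 * (6 * 21) + 44 ≤? 3 * 2 ^ 20)
linear≤exponential (suc i) = begin
  d * (6 * suc (suc h)) + c                            ≤⟨ m≤m+n _ (d * (6 * h) + c) ⟩
  d * (6 * suc (suc h)) + c + (d * (6 * h) + c)        ≡⟨ shuffle d c h ⟩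
  2 * (d * (6 * suc h) + c)                            ≤⟨ *-monoʳ-≤ 2 (linear≤exponential i) ⟩
  2 * (3 * 2 ^ h)                                      ≡⟨ shuffle′ (2 ^ h) ⟩
  3 * (2 * 2 ^ h) ∎
  where
  open ≤-Reasoning
  h d c : ℕ
  h = i + 20
  d = 100 * 100
  c = 44
  shuffle : ∀ d c h → d * (6 * suc (suc h)) + c + (d * (6 * h) + c) ≡ 2 * (d * (6 * suc h) + c)
  shuffle = solve-∀
  shuffle′ : ∀ x → 2 * (3 * x) ≡ 3 * (2 * x)
  shuffle′ = solve-∀

abstract
  -- The exponent 40 gives L ≥ 40 and h = L / 2 ≥ 20, where `error≤` and `linear≤exponential` take
  -- hold. The same number is the constant of the theorem: it bounds N + 1 in the singleton case and
  -- exceeds the factor 60 · 100 · 2 from the count of primes.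
  N₀ : ℕ
  N₀ = 2 ^ 40

  N₀≡2^40 : N₀ ≡ 2 ^ 40
  N₀≡2^40 = refl

  12000≤N₀ : 60 * 100 * 2 ≤ N₀
  12000≤N₀ = from-yes (60 * 100 * 2 ≤? N₀)

-- With X = 2^h, which is about √N, the error is at most X times an affine function of h, hence at
-- most 3 X² ≤ 90 (n + 1). It uses up 99 n of the available 199 n.
errorTerm≤ : ∀ L h n → 20 ≤ h → suc L ≤ 2 * suc h → 2 ^ h * 2 ^ h ≤ 30 * suc n →
             100 * 100 * (suc L * suc (2 ^ suc h)) + (121 * 181 + 100 * 100 + 100 * β) ≤ 99 * n + 90
errorTerm≤ L h n 20≤h L≤ X²≤ = begin
  d * (suc L * suc (2 * X)) + (121 * 181 + 100 * 100 + 100 * β)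
    ≤⟨ +-mono-≤ (*-monoʳ-≤ d (*-mono-≤ L≤ (+-monoˡ-≤ (2 * X) 1≤X))) (≤-trans error≤ (*-monoʳ-≤ 44 2^20≤X)) ⟩
  d * (2 * suc h * (X + 2 * X)) + 44 * X                  ≡⟨ shuffle d h X 44 ⟩
  X * (d * (6 * suc h) + 44)                       ≤⟨ *-monoʳ-≤ X growth ⟩
  X * (3 * X)                                             ≡⟨ shuffle′ X ⟩
  3 * (X * X)                                             ≤⟨ *-monoʳ-≤ 3 X²≤ ⟩
  3 * (30 * suc n)                                        ≡⟨ shuffle″ n ⟩
  90 * n + 90                                             ≤⟨ +-monoˡ-≤ 90 (*-monoˡ-≤ n (from-yes (90 ≤? 99))) ⟩
  99 * n + 90 ∎
  where
  open ≤-Reasoning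
  d X : ℕ
  d = 100 * 100
  X = 2 ^ h
  1≤X : 1 ≤ X
  1≤X = m^n>0 2 h
  2^20≤X : 2 ^ 20 ≤ X
  2^20≤X = ^-monoʳ-≤ 2 20≤h
  growth : d * (6 * suc h) + 44 ≤ 3 * X
  growth = subst (λ w → d * (6 * suc w) + 44 ≤ 3 * 2 ^ w) (m∸n+n≡m 20≤h) (linear≤exponential (h ∸ 20))
  shuffle : ∀ d h x e → d * (2 * suc h * (x + 2 * x)) + e * x ≡ x * (d * (6 * suc h) + e)
  shuffle = solve-∀
  shuffle′ : ∀ x → x * (3 * x) ≡ 3 * (x * x)
  shuffle′ = solve-∀
  shuffle″ : ∀ n → 3 * (30 * suc n) ≡ 90 * n + 90
  shuffle″ = solve-∀

primesBetween-abundant : ∀ l N → N₀ ≤ N → 100 * l ≤ 81 * suc N →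
  ∃[ L ] (2 ^ L ≤ N × suc N ≤ 60 * (100 * ((L + L) * length (primesBetween l N))))
primesBetween-abundant l N N₀≤N 100l≤ with binaryLength N (≤-trans (m^n>0 2 40) (subst (_≤ N) N₀≡2^40 N₀≤N))
... | L , lo , hi = L , lo , (begin
  suc N                         ≤⟨ n<30[1+n/30] N ⟩
  30 * suc n                    ≤⟨ *-monoʳ-≤ 30 (+-monoˡ-≤ n 1≤n) ⟩
  30 * (n + n)                  ≡⟨ shuffle n ⟩
  60 * n                        ≤⟨ *-monoʳ-≤ 60 n≤ ⟩
  60 * (100 * (suc L * k))      ≤⟨ *-monoʳ-≤ 60 (*-monoʳ-≤ 100 (*-monoˡ-≤ k (+-monoˡ-≤ L 1≤L))) ⟩
  60 * (100 * ((L + L) * k)) ∎)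
  where
  open ≤-Reasoning
  shuffle : ∀ n → 30 * (n + n) ≡ 60 * n
  shuffle = solve-∀
  h n m k s : ℕ
  h = L / 2
  n = N / 30
  m = suc (l / 30)
  k = length (primesBetween l N)
  s = 2 ^ suc h
  2^40≤N : 2 ^ 40 ≤ N
  2^40≤N = subst (_≤ N) N₀≡2^40 N₀≤N
  40≤L : 40 ≤ L
  40≤L = ≤-pred (≰⇒> (λ L<40 → <⇒≱ hi (≤-trans (^-monoʳ-≤ 2 L<40) 2^40≤N)))
  1≤L : 1 ≤ L
  1≤L = ≤-trans (from-yes (1 ≤? 40)) 40≤L
  20≤h : 20 ≤ h
  20≤h = /-monoˡ-≤ 2 40≤L
  1≤n : 1 ≤ n
  1≤n = m≥n⇒m/n>0 (≤-trans (from-yes (30 ≤? 2 ^ 40)) 2^40≤N)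
  L<2h+2 : suc L ≤ 2 * suc h
  L<2h+2 = begin
    suc L                   ≡⟨ cong suc (m≡m%n+[m/n]*n L 2) ⟩
    suc (L % 2 + h * 2)     ≤⟨ +-monoˡ-≤ (h * 2) (m%n<n L 2) ⟩
    suc h * 2               ≡⟨ *-comm (suc h) 2 ⟩
    2 * suc h ∎
  N<s² : N < s * s
  N<s² = begin-strict
    N                       <⟨ hi ⟩
    2 ^ suc L               ≤⟨ ^-monoʳ-≤ 2 L<2h+2 ⟩
    2 ^ (2 * suc h)         ≡⟨ cong (λ w → 2 ^ (suc h + w)) (+-identityʳ (suc h)) ⟩
    2 ^ (suc h + suc h)     ≡⟨ ^-distribˡ-+-* 2 (suc h) (suc h) ⟩
    s * s ∎
  X²≤ : 2 ^ h * 2 ^ h ≤ 30 * suc n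
  X²≤ = begin
    2 ^ h * 2 ^ h           ≡⟨ sym (^-distribˡ-+-* 2 h h) ⟩
    2 ^ (h + h)             ≤⟨ ^-monoʳ-≤ 2 (subst (_≤ L) (trans (*-comm h 2) (cong (h +_) (+-identityʳ h))) (m/n*n≤m L 2)) ⟩
    2 ^ L                   ≤⟨ lo ⟩
    N                       ≤⟨ <⇒≤ (n<30[1+n/30] N) ⟩
    30 * suc n ∎
  100m≤ : 100 * m ≤ 81 * n + 181
  -- The rounding loss 181 is 81 from N + 1 ≤ 30 (n + 1) plus 100 from m = l / 30 + 1.
  100m≤ = *-cancelˡ-≤ 30 (begin
    30 * (100 * suc (l / 30))              ≡⟨ shuffle₁ 30 100 (l / 30) ⟩
    100 * (l / 30 * 30) + 30 * 100         ≤⟨ +-monoˡ-≤ (30 * 100) (*-monoʳ-≤ 100 (m/n*n≤m l 30)) ⟩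
    100 * l + 30 * 100                     ≤⟨ +-monoˡ-≤ (30 * 100) 100l≤ ⟩
    81 * suc N + 30 * 100                  ≤⟨ +-monoˡ-≤ (30 * 100) (*-monoʳ-≤ 81 (n<30[1+n/30] N)) ⟩
    81 * (30 * suc n) + 30 * 100           ≡⟨ shuffle₂ 30 81 100 n ⟩
    30 * (81 * n + (81 + 100)) ∎)
    where
    shuffle₁ : ∀ a b t → a * (b * suc t) ≡ b * (t * a) + a * b
    shuffle₁ = solve-∀
    shuffle₂ : ∀ a b c n → b * (a * suc n) + a * c ≡ a * (b * n + (b + c))
    shuffle₂ = solve-∀
  n≤ : n ≤ 100 * (suc L * k)
  -- Cancelling 99 n leaves 100 n < 100 (Y + 1), strict because 90 < 100. Hence n ≤ Y, and no
  -- additive constant survives.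
  n≤ = ≤-pred (*-cancelˡ-< 100 n (suc Y) (+-cancelˡ-< (99 * n) _ _ (begin-strict
    99 * n + 100 * n                                           ≡⟨ sym (*-distribʳ-+ n 99 100) ⟩
    199 * n                                                    ≤⟨ primesBetween-bound l N s L n m 1≤n
        (subst (_≤ N) (*-comm n 30) (m/n*n≤m N 30)) (<⇒≤ (n<30[1+n/30] l)) N<s² hi 100m≤ ⟩
    100 * 100 * (suc L * k) + (100 * 100 * (suc L * suc s) + (121 * 181 + 100 * 100 + 100 * β))
                                                               ≤⟨ +-monoʳ-≤ _ (errorTerm≤ L h n 20≤h L<2h+2 X²≤) ⟩
    100 * 100 * (suc L * k) + (99 * n + 90)                    <⟨ +-monoʳ-< (100 * 100 * (suc L * k)) (+-monoʳ-< (99 * n) (from-yes (90 <? 100))) ⟩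
    100 * 100 * (suc L * k) + (99 * n + 100)                   ≡⟨ shuffle₁ 100 (suc L * k) (99 * n) ⟩
    99 * n + 100 * suc Y ∎)))
    where
    Y : ℕ
    Y = 100 * (suc L * k)
    shuffle₁ : ∀ c y x → c * c * y + (x + c) ≡ x + c * suc (c * y)
    shuffle₁ = solve-∀

-- Packing sets

deduplicate-unique : ∀ {xs} → Unique xs → deduplicate _≟_ xs ≡ xs
deduplicate-unique []                    = refl
deduplicate-unique {x ∷ xs} (x∉xs ∷ xs!) rewrite deduplicate-unique xs! = cong (x ∷_) (filter-all (λ y → ¬? (x ≟ y)) x∉xs)

module _ {a b c} {X : Set a} {Y : Set b} {Z : Set c} (f : X → Y → Z) where

  length-cartesianProductWith : ∀ xs ys → length (cartesianProductWith f xs ys) ≡ length xs * length ys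
  length-cartesianProductWith []       ys = refl
  length-cartesianProductWith (x ∷ xs) ys = trans (length-++ (map (f x) ys))
    (cong₂ _+_ (length-map (f x) ys) (length-cartesianProductWith xs ys))

  -- Injectivity is asked for members of the lists only, since multiplication modulo p is not
  -- injective on all pairs.
  cartesianProductWith-! : ∀ {xs ys} →
    (∀ {x x′ y y′} → x ∈ xs → x′ ∈ xs → y ∈ ys → y′ ∈ ys → f x y ≡ f x′ y′ → x ≡ x′ × y ≡ y′) →
    Unique xs → Unique ys → Unique (cartesianProductWith f xs ys)
  cartesianProductWith-! {[]}              inj []           ys! = []
  cartesianProductWith-! {x ∷ xs} {ys = ys} inj (x∉xs ∷ xs!) ys! = Unique-++⁺
    (map-! (λ y∈ y′∈ → proj₂ ∘ inj (here refl) (here refl) y∈ y′∈) ys!)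
    (cartesianProductWith-! (λ x∈ x′∈ → inj (there x∈) (there x′∈)) xs! ys!)
    disjoint
    where
    map-! : ∀ {ys} → (∀ {y y′} → y ∈ ys → y′ ∈ ys → f x y ≡ f x y′ → y ≡ y′) → Unique ys → Unique (map (f x) ys)
    map-! inj []           = []
    map-! inj (y∉ys ∷ ys!) = All-map⁺ (All.tabulate (λ y′∈ eq → All.lookup y∉ys y′∈ (inj (here refl) (there y′∈) eq)))
                             ∷ map-! (λ y∈ y′∈ → inj (there y∈) (there y′∈)) ys!
    disjoint : ∀ {v} → ¬ (v ∈ map (f x) ys × v ∈ cartesianProductWith f xs ys)
    disjoint (v∈map , v∈prod) with ∈-map⁻ (f x) v∈map | ∈-cartesianProductWith⁻ f xs ys v∈prod
    ... | y , y∈ , refl | x′ , y′ , x′∈ , y′∈ , eq =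
      All.lookup x∉xs x′∈ (proj₁ (inj (here refl) (there x′∈) y∈ y′∈ eq))

∈-interval : ∀ {l a} → a ∈ interval l → 1 ≤ a × a ≤ l
∈-interval a∈ with ∈-map⁻ suc a∈
... | i , i∈ , refl = s≤s z≤n , ∈-upTo⁻ i∈

-- All products a b with a ≤ l are smaller than p, so that they can be compared as integers.
interval-packing : ∀ p .{{_ : NonZero p}} l B → 1 ≤ l → Unique B → All (λ b → 1 ≤ b × l * b < p) B →
  (∀ {a a′ b b′} → 1 ≤ a → a ≤ l → 1 ≤ a′ → a′ ≤ l → b ∈ B → b′ ∈ B → a * b ≡ a′ * b′ → b ≡ b′) →
  IsPackingSet p (interval l) B
interval-packing p l B 1≤l B! small inj =
  (B! , All.map (λ (1≤b , l*b<p) → 1≤b , ≤-<-trans (m≤n*m _ l {{>-nonZero 1≤l}}) l*b<p) small) ,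
  trans (cong length (deduplicate-unique products!)) (length-cartesianProductWith f (interval l) B)
  where
  f : ℕ → ℕ → ℕ
  f a b = (a * b) % p
  f≡* : ∀ {a b} → a ∈ interval l → b ∈ B → f a b ≡ a * b
  f≡* a∈ b∈ = m<n⇒m%n≡m (≤-<-trans (*-monoˡ-≤ _ (proj₂ (∈-interval a∈))) (proj₂ (All.lookup small b∈)))
  injective : ∀ {a a′ b b′} → a ∈ interval l → a′ ∈ interval l → b ∈ B → b′ ∈ B → f a b ≡ f a′ b′ → a ≡ a′ × b ≡ b′
  injective {a} {a′} {b} {b′} a∈ a′∈ b∈ b′∈ eq = a≡a′ , b≡b′
    where
    ab≡a′b′ : a * b ≡ a′ * b′
    ab≡a′b′ = trans (sym (f≡* a∈ b∈)) (trans eq (f≡* a′∈ b′∈))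
    b≡b′ : b ≡ b′
    b≡b′ = inj (proj₁ (∈-interval a∈)) (proj₂ (∈-interval a∈)) (proj₁ (∈-interval a′∈)) (proj₂ (∈-interval a′∈)) b∈ b′∈ ab≡a′b′
    a≡a′ : a ≡ a′
    a≡a′ = *-cancelʳ-≡ a a′ b {{>-nonZero (proj₁ (All.lookup small b∈))}} (trans ab≡a′b′ (cong (a′ *_) (sym b≡b′)))
  products! : Unique (cartesianProductWith f (interval l) B)
  products! = cartesianProductWith-! f injective (Unique-map⁺ suc-injective (upTo⁺ l)) B!

singleton-packing : ∀ p .{{_ : NonZero p}} l → 1 ≤ l → l < p → IsPackingSet p (interval l) (1 ∷ [])
singleton-packing p l 1≤l l<p = interval-packing p l (1 ∷ []) 1≤l ([] ∷ [])
  ((≤-refl , subst (_< p) (sym (*-identityʳ l)) l<p) ∷ []) (λ { _ _ _ _ (here refl) (here refl) _ → refl })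

-- If a b = a′ b′, the prime b divides a′ b′. It cannot divide a′, as 0 < a′ ≤ l < b, so it divides
-- the prime b′ and equals it.
primesBetween-packing : ∀ p .{{_ : NonZero p}} l N → 1 ≤ l → l * N < p → IsPackingSet p (interval l) (primesBetween l N)
primesBetween-packing p l N 1≤l l*N<p = interval-packing p l (primesBetween l N) 1≤l (primesBetween-! l N)
    (All.map (λ (l<q , q≤N , _) → ≤-trans 1≤l (<⇒≤ l<q) , ≤-<-trans (*-monoʳ-≤ l q≤N) l*N<p) primes) coprime
  where
  primes : All (λ q → l < q × q ≤ N × Prime q) (primesBetween l N)
  primes = primesBetween-∈ l N
  coprime : ∀ {a a′ b b′} → 1 ≤ a → a ≤ l → 1 ≤ a′ → a′ ≤ l → b ∈ primesBetween l N → b′ ∈ primesBetween l N →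
            a * b ≡ a′ * b′ → b ≡ b′
  coprime {a} {a′} {b} {b′} _ _ 1≤a′ a′≤l b∈ b′∈ eq with All.lookup primes b∈ | All.lookup primes b′∈
  ... | l<b , _ , pb | _ , _ , pb′ with euclidsLemma a′ b′ pb (divides a (sym eq))
  ...   | inj₁ b∣a′ = contradiction b∣a′ (>⇒∤ {{>-nonZero 1≤a′}} (≤-<-trans a′≤l l<b))
  ...   | inj₂ b∣b′ = prime∣prime⇒≡ pb pb′ b∣b′

-- Choice of the packing set and the final constant

-- The quadratic hypothesis on l becomes linear: p ≤ l (N + 1) supplies a factor l that cancels
-- against l².
100l≤81[1+N] : ∀ l N p → 1 ≤ l → p ≤ l * suc N → 100 * (l * l) ≤ 81 * p → 100 * l ≤ 81 * suc N
100l≤81[1+N] l N p 1≤l p≤ l²≤ = *-cancelʳ-≤ (100 * l) (81 * suc N) l {{>-nonZero 1≤l}} (begin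
  100 * l * l             ≡⟨ *-assoc 100 l l ⟩
  100 * (l * l)           ≤⟨ l²≤ ⟩
  81 * p                  ≤⟨ *-monoʳ-≤ 81 p≤ ⟩
  81 * (l * suc N)        ≡⟨ cong (81 *_) (*-comm l (suc N)) ⟩
  81 * (suc N * l)        ≡⟨ sym (*-assoc 81 (suc N) l) ⟩
  81 * suc N * l ∎)
  where open ≤-Reasoning

100l²≤81p⇒l<p : ∀ l p → 1 ≤ p → 100 * (l * l) ≤ 81 * p → l < p
100l²≤81p⇒l<p l p 1≤p l²≤ = ≰⇒> (λ p≤l → <⇒≱ (begin-strict
  81 * p                  <⟨ *-monoˡ-< p {{>-nonZero 1≤p}} (from-yes (81 <? 100)) ⟩
  100 * p                 ≤⟨ *-monoʳ-≤ 100 (≤-trans p≤l (m≤n*m l l {{>-nonZero (≤-trans 1≤p p≤l)}})) ⟩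
  100 * (l * l) ∎) l²≤)
  where open ≤-Reasoning

singleton-bound : ∀ p l N G → p ≤ l * suc N → N < N₀ → 1 ≤ G → p ≤ N₀ * 1 * l * G
singleton-bound p l N G p≤ N<N₀ 1≤G = begin
  p                     ≤⟨ p≤ ⟩
  l * suc N             ≤⟨ *-monoʳ-≤ l N<N₀ ⟩
  l * N₀                ≡⟨ trans (*-comm l N₀) (cong (_* l) (sym (*-identityʳ N₀))) ⟩
  N₀ * 1 * l            ≤⟨ m≤m*n (N₀ * 1 * l) G {{>-nonZero 1≤G}} ⟩
  N₀ * 1 * l * G ∎
  where open ≤-Reasoning

primes-bound : ∀ p l N k L G → p ≤ l * suc N → suc N ≤ 60 * (100 * ((L + L) * k)) → L ≤ G → p ≤ N₀ * k * l * G
primes-bound p l N k L G p≤ N< L≤G = begin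
  p                                        ≤⟨ p≤ ⟩
  l * suc N                                ≤⟨ *-monoʳ-≤ l N< ⟩
  l * (60 * (100 * ((L + L) * k)))         ≡⟨ shuffle l 60 100 L k ⟩
  60 * 100 * 2 * k * l * L                 ≤⟨ *-mono-≤ (*-monoˡ-≤ l (*-monoˡ-≤ k 12000≤N₀)) L≤G ⟩
  N₀ * k * l * G ∎
  where
  open ≤-Reasoning
  shuffle : ∀ l a b L k → l * (a * (b * ((L + L) * k))) ≡ a * b * 2 * k * l * L
  shuffle = solve-∀

packing : ∀ p → .{{_ : NonZero p}} → Prime p → ∀ l → 1 ≤ l → 100 * (l * l) ≤ 81 * p →
          ∃[ B ] (IsPackingSet p (interval l) B × p ≤ N₀ * length B * l * ⌊log₂ p ⌋)
packing p pp l 1≤l l²≤ = packingSet (N₀ ≤? N)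
  where
  instance
    l≢0 : NonZero l
    l≢0 = >-nonZero 1≤l
  N : ℕ
  N = pred p / l
  1<p : 1 < p
  1<p = nonTrivial⇒n>1 p {{prime⇒nonTrivial pp}}
  l*N<p : l * N < p
  l*N<p = begin-strict
    l * N            ≡⟨ *-comm l N ⟩
    N * l            ≤⟨ m/n*n≤m (pred p) l ⟩
    pred p           <⟨ ≤-refl ⟩
    suc (pred p)     ≡⟨ suc-pred p ⟩
    p ∎
    where open ≤-Reasoning
  p≤l[1+N] : p ≤ l * suc N
  p≤l[1+N] = begin
    p                           ≡⟨ sym (suc-pred p) ⟩
    suc (pred p)                ≡⟨ cong suc (m≡m%n+[m/n]*n (pred p) l) ⟩
    suc (pred p % l) + N * l    ≤⟨ +-monoˡ-≤ (N * l) (m%n<n (pred p) l) ⟩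
    suc N * l                   ≡⟨ *-comm (suc N) l ⟩
    l * suc N ∎
    where open ≤-Reasoning
  packingSet : Dec (N₀ ≤ N) → ∃[ B ] (IsPackingSet p (interval l) B × p ≤ N₀ * length B * l * ⌊log₂ p ⌋)
  packingSet (no N₀≰N) = 1 ∷ [] , singleton-packing p l 1≤l (100l²≤81p⇒l<p l p (<⇒≤ 1<p) l²≤) ,
    singleton-bound p l N ⌊log₂ p ⌋ p≤l[1+N] (≰⇒> N₀≰N) (⌊log₂⌋-mono-≤ 1<p)
  packingSet (yes N₀≤N) = fromPrimes (primesBetween-abundant l N N₀≤N (100l≤81[1+N] l N p 1≤l p≤l[1+N] l²≤))
    where
    k : ℕ
    k = length (primesBetween l N)
    fromPrimes : ∃[ L ] (2 ^ L ≤ N × suc N ≤ 60 * (100 * ((L + L) * k))) →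
                 ∃[ B ] (IsPackingSet p (interval l) B × p ≤ N₀ * length B * l * ⌊log₂ p ⌋)
    fromPrimes (L , 2^L≤N , N<) = primesBetween l N , primesBetween-packing p l N 1≤l l*N<p ,
        primes-bound p l N k L ⌊log₂ p ⌋ p≤l[1+N] N< L≤log
      where
      L≤log : L ≤ ⌊log₂ p ⌋
      L≤log = subst (_≤ ⌊log₂ p ⌋) (⌊log₂[2^n]⌋≡n L) (⌊log₂⌋-mono-≤ (≤-trans 2^L≤N (≤-trans (m/n≤m (pred p) l) (pred[n]≤n {p}))))

-- The condition l ≤ 0.9 √p is squared and cleared of denominators. As ⌊log₂ p⌋ ≤ log p / log 2, the
-- conclusion gives ν(A) ≥ c p / (l log p) with c = (log 2) / K.
mainTheorem3 : ∃[ K ] (1 ≤ K × ((p : ℕ) → .{{_ : NonZero p}} → Prime p → (l : ℕ) → 1 ≤ l → 100 * (l * l) ≤ 81 * p →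
    ∃[ B ] (IsPackingSet p (interval l) B × p ≤ K * length B * l * ⌊log₂ p ⌋)))
mainTheorem3 = N₀ , ≤-trans (from-yes (1 ≤? 60 * 100 * 2)) 12000≤N₀ , packing
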